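{- The problem $\mathrm{LCR}$ can be solved in time $\mathcal{O}(2^{\mathtt{C}}\cdot\mathtt{C}^4\cdot\mathtt{L}^2\cdot\mathtt{D}^2)$.
   Context: Programs. A (shared memory) program is a tuple $\mathcal{A}=(D,a^0,(P_i)_{i\in[1..t]})$ with a finite data domain $D$, an initial memory value $a^0\in D$, and threads $P_i$. Let $\mathrm{Op}(D)=\{!a,?a \mid a\in D\}$ ($!a$ writes $a$ to the memory, $?a$ reads $a$ from it). Each thread is a nondeterministic finite automaton $P_i=(\mathrm{Op}(D),Q_i,q_i^0,\delta_i)$ with finite state set $Q_i$, initial state $q_i^0$ and transition relation $\delta_i\subseteq Q_i\times(\mathrm{Op}(D)\cup\{\varepsilon\})\times Q_i$. A configuration is a pair $(\mathit{pc},a)$ with $\mathit{pc}\in Q_1\times\dots\times Q_t$ and $a\in D$; the initial configuration is $c^0=((q_1^0,\dots,q_t^0),a^0)$. A step lets one thread $P_i$ take a transition from its current state $q$ to $q'$ (the other threads keep their states): a transition $(q,?a,q')$ is possible only if the memory holds $a$, and leaves the memory unchanged; a transition $(q,!b,q')$ is possible for any memory value and sets the memory to $b$; a transition $(q,\varepsilon,q')$ leaves the memory unchanged. Write $c\rightarrow^*_{\mathcal{A}}c'$ if $c'$ is reachable from $c$ by a finite sequence of steps. Leader Contributor Reachability ($\mathrm{LCR}$). Input: a program $\mathcal{A}=(D,a^0,(P_L,P_C))$ with two threads, the leader $P_L$ (state set $Q_L$) and the contributor $P_C$ (state set $Q_C$), and a set $F_L\subseteq Q_L$ of unsafe states. For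 $t\in\mathbb{N}$, let $\mathcal{A}^t=(D,a^0,(P_L,(P_C)_{i\in[1..t]}))$ be the program with one leader and exactly $t$ copies of $P_C$, and let $C^f$ be the set of configurations in which the leader is in a state of $F_L$. Question: is there a $t\in\mathbb{N}$ such that $c^0\rightarrow^*_{\mathcal{A}^t}c$ for some $c\in C^f$? Parameters: $\mathtt{D}=|D|$, $\mathtt{L}=|Q_L|$, $\mathtt{C}=|Q_C|$. -}

module Defs where

open import Data.Bool using (Bool; true; if_then_else_)
open import Data.Fin using (Fin; zero; suc; toℕ; fromℕ<; remQuot; splitAt)
open import Data.Fin.Subset using (Subset; _∈_)
open import Data.Maybe using (Maybe; just; nothing)
open import Data.Nat
  using (ℕ; zero; suc; _+_; _*_; _∸_; _≤_; _<?_; _≡ᵇ_)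
open import Data.Product using (Σ; ∃-syntax; _×_; _,_)
open import Data.Sum using ([_,_]′)
open import Data.Vec using (lookup)
open import Data.Vec.Functional using (_∷_; replicate)
open import Function using (_⇔_)
open import Relation.Binary.Construct.Closure.ReflexiveTransitive using (Star)
open import Relation.Binary.PropositionalEquality using (_≡_; _≢_)
open import Relation.Nullary using (yes; no)

data Op (A : Set) : Set where
  wr rd : A → Op A

-- A transition label is `nothing` for ε.
record NFA (A : Set) : Set where
  field
    size : ℕ
    q⁰   : Fin size
    δ    : Fin size → Maybe A → Fin size → Bool

open NFA public

record Program : Set where
  field
    dom     : ℕ
    a⁰      : Fin dom
    t       : ℕ
    threads : Fin t → NFA (Op (Fin dom))

module _ (𝒜 : Program) where
  open Program 𝒜

  Config : Set
  Config = ((i : Fin t) → Fin (size (threads i))) × Fin dom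

  initial : Config
  initial = (λ i → q⁰ (threads i)) , a⁰

  data Effect : Maybe (Op (Fin dom)) → Fin dom → Fin dom → Set where
    ε     : ∀ {a}   → Effect nothing a a
    read  : ∀ {a}   → Effect (just (rd a)) a a
    write : ∀ {a b} → Effect (just (wr b)) a b

  data Step : Config → Config → Set where
    step : ∀ {pc pc′ a a′} (i : Fin t) (o : Maybe (Op (Fin dom))) →
           δ (threads i) (pc i) o (pc′ i) ≡ true →
           (∀ j → j ≢ i → pc′ j ≡ pc j) →
           Effect o a a′ →
           Step (pc , a) (pc′ , a′)

  Reaches : Config → Config → Set
  Reaches = Star Step

record Instance : Set where
  field
    dom         : ℕ
    a⁰          : Fin dom
    leader      : NFA (Op (Fin dom))
    contributor : NFA (Op (Fin dom))
    unsafe      : Subset (size leader)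

  𝙳 𝙻 𝙲 : ℕ
  𝙳 = dom
  𝙻 = size leader
  𝙲 = size contributor

  𝒜^ : ℕ → Program
  𝒜^ t = record
    { dom     = dom
    ; a⁰      = a⁰
    ; t       = suc t
    ; threads = leader ∷ replicate t contributor
    }

  Bad : ∀ t → Config (𝒜^ t) → Set
  Bad t (pc , _) = pc zero ∈ unsafe

LCR : Instance → Set
LCR I = ∃[ t ] ∃[ c ] Reaches (𝒜^ t) (initial (𝒜^ t)) c × Bad t c
  where open Instance I

-- Word RAM, presented as a structured language.  The memory consists of
-- registers and of one-dimensional arrays; a command mentions only finitely
-- many of either, so that interleaving turns them into a single memory with
-- constant overhead.

record State : Set where
  constructor ⟨_,_⟩
  field
    reg : ℕ → ℕ
    arr : ℕ → ℕ → ℕ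

open State public

infixr 8 _!_
infixl 7 _⊗_
infixl 6 _⊕_ _⊖_

data Exp : Set where
  con         : ℕ → Exp
  var         : ℕ → Exp
  _!_         : ℕ → Exp → Exp
  _⊕_ _⊖_ _⊗_ : Exp → Exp → Exp

⟦_⟧ : Exp → State → ℕ
⟦ con n ⟧   s = n
⟦ var x ⟧   s = reg s x
⟦ A ! e ⟧ s = arr s A (⟦ e ⟧ s)
⟦ e ⊕ f ⟧   s = ⟦ e ⟧ s + ⟦ f ⟧ s
⟦ e ⊖ f ⟧   s = ⟦ e ⟧ s ∸ ⟦ f ⟧ s
⟦ e ⊗ f ⟧   s = ⟦ e ⟧ s * ⟦ f ⟧ s

cost : Exp → ℕ
cost (con n)   = 1
cost (var x)   = 1
cost (A ! e)   = 1 + cost e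
cost (e ⊕ f)   = 1 + cost e + cost f
cost (e ⊖ f)   = 1 + cost e + cost f
cost (e ⊗ f)   = 1 + cost e + cost f

infix  5 _≔_ _[_]≔_
infixr 4 _⨾_

data Cmd : Set where
  skip   : Cmd
  _≔_    : ℕ → Exp → Cmd
  _[_]≔_ : ℕ → Exp → Exp → Cmd
  _⨾_    : Cmd → Cmd → Cmd
  branch : Exp → Cmd → Cmd → Cmd
  while  : Exp → Cmd → Cmd

update : {A : Set} → (ℕ → A) → ℕ → A → ℕ → A
update f i a j = if j ≡ᵇ i then a else f j

-- W ⊢ c , s ⇓ s′ ⟨ n ⟩: run from s, the command c halts in s′ after n unit-cost
-- operations and never stores a value above W.  Expressions have constant
-- size, so their intermediate values, and hence all addresses, then have
-- O(log W) bits.  Nonzero guards count as true.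
infix 3 _⊢_,_⇓_⟨_⟩

data _⊢_,_⇓_⟨_⟩ (W : ℕ) : Cmd → State → State → ℕ → Set where

  skip : ∀ {s} → W ⊢ skip , s ⇓ s ⟨ 1 ⟩

  assign : ∀ {x e s} →
    ⟦ e ⟧ s ≤ W →
    W ⊢ x ≔ e , s ⇓ ⟨ update (reg s) x (⟦ e ⟧ s) , arr s ⟩ ⟨ 1 + cost e ⟩

  store : ∀ {A i e s} →
    ⟦ e ⟧ s ≤ W →
    W ⊢ A [ i ]≔ e , s
      ⇓ ⟨ reg s , update (arr s) A (update (arr s A) (⟦ i ⟧ s) (⟦ e ⟧ s)) ⟩
      ⟨ 1 + cost i + cost e ⟩

  seq : ∀ {c d s s′ s″ m n} →
    W ⊢ c , s ⇓ s′ ⟨ m ⟩ →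
    W ⊢ d , s′ ⇓ s″ ⟨ n ⟩ →
    W ⊢ c ⨾ d , s ⇓ s″ ⟨ m + n ⟩

  branch-true : ∀ {e c d s s′ n} →
    ⟦ e ⟧ s ≢ 0 →
    W ⊢ c , s ⇓ s′ ⟨ n ⟩ →
    W ⊢ branch e c d , s ⇓ s′ ⟨ 1 + cost e + n ⟩

  branch-false : ∀ {e c d s s′ n} →
    ⟦ e ⟧ s ≡ 0 →
    W ⊢ d , s ⇓ s′ ⟨ n ⟩ →
    W ⊢ branch e c d , s ⇓ s′ ⟨ 1 + cost e + n ⟩

  while-true : ∀ {e c s s′ s″ m n} →
    ⟦ e ⟧ s ≢ 0 →
    W ⊢ c , s ⇓ s′ ⟨ m ⟩ →
    W ⊢ while e c , s′ ⇓ s″ ⟨ n ⟩ →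
    W ⊢ while e c , s ⇓ s″ ⟨ 1 + cost e + m + n ⟩

  while-false : ∀ {e c s} →
    ⟦ e ⟧ s ≡ 0 →
    W ⊢ while e c , s ⇓ s ⟨ 1 + cost e ⟩

-- Time O(f): one fixed command answers every input x (in register 0, nonzero
-- for "yes") within K * f x operations.  Unit cost is justified only for words
-- of O(log f) bits, so the same bound is imposed on the stored values.
SolvableInTime : {X : Set} (encode : X → State) (Problem : X → Set)
                 (f : X → ℕ) → Set
SolvableInTime {X} encode Problem f =
  Σ Cmd λ c → Σ ℕ λ K → (x : X) →
    ∃[ s ] ∃[ n ] (K * f x ⊢ c , encode x ⇓ s ⟨ n ⟩)
                × n ≤ K * f x
                × (reg s 0 ≢ 0 ⇔ Problem x)

-- Inputs: the six numbers of an instance in registers 0 to 5, the bit tables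
-- of the two transition relations and of the unsafe states in arrays 0 to 2,
-- and 0 everywhere else.

table : ∀ {n} → (Fin n → Bool) → ℕ → ℕ
table {n} f i with i <? n
... | yes i<n = if f (fromℕ< i<n) then 1 else 0
... | no  _   = 0

-- ε, wr a and rd a have the codes 0, 1 + a and 1 + d + a.
label : ∀ {d} → Fin (1 + (d + d)) → Maybe (Op (Fin d))
label         zero    = nothing
label {d = d} (suc k) = just ([ wr , rd ]′ (splitAt d k))

-- With m states, (q , o , q′) is at index (k * m + q) * m + q′, where k is
-- the code of o.
transitions : ∀ {d} (P : NFA (Op (Fin d))) →
              Fin ((1 + (d + d)) * size P * size P) → Bool
transitions {d} P i =
  let (kq , q′) = remQuot {(1 + (d + d)) * size P} (size P) i
      (k  , q ) = remQuot {1 + (d + d)} (size P) kq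
  in  δ P q (label k) q′

encode : Instance → State
encode I = ⟨ registers , arrays ⟩
  where
  open Instance I

  registers : ℕ → ℕ
  registers 0 = 𝙳
  registers 1 = 𝙻
  registers 2 = 𝙲
  registers 3 = toℕ a⁰
  registers 4 = toℕ (q⁰ leader)
  registers 5 = toℕ (q⁰ contributor)
  registers _ = 0

  arrays : ℕ → ℕ → ℕ
  arrays 0 = table (transitions leader)
  arrays 1 = table (transitions contributor)
  arrays 2 = table (lookup unsafe)
  arrays _ = λ _ → 0

{-# OPTIONS --safe #-}
module Submission where

-- Contributors are anonymous and unlimited: next to any contributor another one
-- can be added that repeats each of its steps right after it, and so can be left
-- behind in its state.  Hence only the set S of contributor states reached so far
-- matters, and it only grows.  Configurations thus collapse to nodes (q , a , S),
-- at most 2 ^ 𝙲 * 𝙻 * 𝙳 many, each with O((𝙻 + 𝙲 ^ 2) * 𝙳) outgoing moves.  A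
-- breadth-first search handles a move in time O(𝙲), most of it spent on computing
-- the number of the target node from the bits of its set.

open import Data.Bool using (Bool; true; false; T; if_then_else_; _∨_)
open import Data.Bool.Properties using (∨-conicalˡ; ∨-conicalʳ)
open import Data.Empty renaming (⊥ to Empty) using ()
open import Data.Fin
  using (Fin; zero; suc; toℕ; fromℕ<; combine; remQuot; _↑ˡ_; _↑ʳ_)
open import Data.Fin.Properties
  using (toℕ<n; fromℕ<-toℕ; toℕ-fromℕ<; toℕ-combine; remQuot-combine; toℕ-↑ˡ; toℕ-↑ʳ;
         splitAt-↑ˡ; splitAt-↑ʳ; toℕ-injective)
  renaming (_≟_ to _≟ᶠ_)
open import Data.Fin.Subset using (Subset; ⊥)
open import Data.Maybe using (Maybe; just; nothing)
open import Data.Nat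
  using (ℕ; zero; suc; _+_; _*_; _∸_; _^_; _≤_; _<_; z≤n; s≤s; _≡ᵇ_; _≤ᵇ_; _<?_; _≟_)
open import Data.Nat.Properties
open import Data.Nat.Tactic.RingSolver using (solve-∀)
open import Data.Product using (∃-syntax; _×_; _,_; proj₁; proj₂)
open import Data.Sum using (_⊎_; inj₁; inj₂; [_,_]′; map₁; map₂)
open import Data.Vec using (lookup; tabulate) renaming (_[_]≔_ to _⟨_⟩≔_)
open import Data.Vec.Properties
  using (lookup∘update; lookup∘update′; lookup-replicate; tabulate∘lookup; tabulate-cong;
         []=⇒lookup; lookup⇒[]=)
open import Function using (_⇔_; mk⇔)
open import Function.Construct.Composition using (_⇔-∘_)
open import Relation.Binary.Construct.Closure.ReflexiveTransitive
  using (_◅_; _◅◅_) renaming (ε to [])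
open import Relation.Binary.PropositionalEquality
open import Relation.Nullary using (¬_; yes; no; contradiction)
open import Defs

-- Abstract configurations

-- The language has no division operation, so a node is not readily recovered from its number. The
-- queue therefore stores leader state, memory value and set bits explicitly, and the number only
-- addresses the table of visited nodes. The claimed bound limits the stored values as well as the
-- time, and both limits rest on one count: a node is enqueued when it is first marked, and no queue
-- position is reused, so the tail equals the number of marks and cannot exceed `capacity`. For
-- completeness the order of the search is irrelevant: it suffices that the marked nodes contain
-- `root` and, once the queue is empty, are closed under moves.

module Abstraction (I : Instance) where
  open Instance I

  record Node : Set where
    constructor node
    field
      lead : Fin 𝙻
      mem  : Fin 𝙳
      set  : Subset 𝙲

  open Node public

  infixl 6 _∪｛_｝

  _∪｛_｝ : Subset 𝙲 → Fin 𝙲 → Subset 𝙲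
  S ∪｛ p ｝ = S ⟨ p ⟩≔ true

  added : ∀ S p → lookup (S ∪｛ p ｝) p ≡ true
  added S p = lookup∘update p S true

  kept : ∀ S p {r} → lookup S r ≡ true → lookup (S ∪｛ p ｝) r ≡ true
  kept S p {r} r∈S with r ≟ᶠ p
  ... | yes refl = added S p
  ... | no  r≢p  = trans (lookup∘update′ r≢p S true) r∈S

  -- The effect of a label does not depend on the number of contributors.
  Eff : Maybe (Op (Fin 𝙳)) → Fin 𝙳 → Fin 𝙳 → Set
  Eff = Effect (𝒜^ 0)

  infix 4 _⟶_

  -- A populated contributor state stays populated: by the copycat argument,
  -- another contributor can be left behind in it.
  data _⟶_ : Node → Node → Set where
    leads       : ∀ {q q′ a a′ S o} → δ leader q o q′ ≡ true → Eff o a a′ →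
                  node q a S ⟶ node q′ a′ S
    contributes : ∀ {q a a′ S p p′ o} → lookup S p ≡ true → δ contributor p o p′ ≡ true →
                  Eff o a a′ → node q a S ⟶ node q a′ (S ∪｛ p′ ｝)

  -- Written as an insertion into the empty set so that the root is pushed by the same command as
  -- every other node: the array `aSet` initially holds only zeros.
  root : Node
  root = node (q⁰ leader) a⁰ (⊥ ∪｛ q⁰ contributor ｝)

  data Reach : Node → Set where
    here : Reach root
    then : ∀ {v w} → Reach v → v ⟶ w → Reach w

  -- Concrete runs project to abstract paths

  toEff : ∀ {t o a a′} → Effect (𝒜^ t) o a a′ → Eff o a a′
  toEff ε     = ε
  toEff read  = read
  toEff write = write

  fromEff : ∀ {t o a a′} → Eff o a a′ → Effect (𝒜^ t) o a a′
  fromEff ε     = ε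
  fromEff read  = read
  fromEff write = write

  -- Only an inclusion of the occupied states in the set: states that all contributors have left
  -- remain in it.
  Abstracts : ∀ {t} → Node → Config (𝒜^ t) → Set
  Abstracts v (pc , a) =
    lead v ≡ pc zero × mem v ≡ a × (∀ i → lookup (set v) (pc (suc i)) ≡ true)

  abstract-step : ∀ {t c c′} v → Abstracts {t} v c → Reach v → Step (𝒜^ t) c c′ →
                  ∃[ w ] Abstracts {t} w c′ × Reach w
  abstract-step (node _ _ S) (refl , refl , pop) r (step {pc′ = pc′} zero o d same e) =
    _ , (refl , refl , λ i → trans (cong (lookup S) (same (suc i) λ ())) (pop i)) ,
    then r (leads d (toEff e))
  abstract-step (node _ _ S) (refl , refl , pop) r
                (step {pc = pc} {pc′ = pc′} (suc i) o d same e) =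
    _ , (sym (same zero λ ()) , refl , pop′) , then r (contributes (pop i) d (toEff e))
    where
    pop′ : ∀ j → lookup (S ∪｛ pc′ (suc i) ｝) (pc′ (suc j)) ≡ true
    pop′ j with j ≟ᶠ i
    ... | yes refl = added S _
    ... | no  j≢i  = trans (cong (lookup (S ∪｛ _ ｝)) (same (suc j) λ { refl → j≢i refl }))
                           (kept S _ (pop j))

  abstract-path : ∀ {t c c′} v → Abstracts {t} v c → Reach v → Reaches (𝒜^ t) c c′ →
                  ∃[ w ] Abstracts {t} w c′ × Reach w
  abstract-path v A r []       = v , A , r
  abstract-path v A r (x ◅ xs) with abstract-step v A r x
  ... | w , B , r′ = abstract-path w B r′ xs

  -- Abstract paths are realised by cloning contributors

  Clone : ∀ {t} → Fin t → Config (𝒜^ t) → Config (𝒜^ (suc t)) → Set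
  Clone i (pc , a) (pc⁺ , a⁺) =
    pc⁺ zero ≡ pc zero × pc⁺ (suc zero) ≡ pc (suc i) ×
    (∀ j → pc⁺ (suc (suc j)) ≡ pc (suc j)) × a⁺ ≡ a

  settle : ∀ {t o a a′} → Effect (𝒜^ t) o a a′ → Effect (𝒜^ t) o a′ a′
  settle ε     = ε
  settle read  = read
  settle write = write

  -- The clone repeats every step of its original right after it; the
  -- repetition is possible as it finds the memory it would itself produce.
  clone-step : ∀ {t c c′} i c⁺ → Clone {t} i c c⁺ → Step (𝒜^ t) c c′ →
               ∃[ d⁺ ] Clone {t} i c′ d⁺ × Reaches (𝒜^ (suc t)) c⁺ d⁺
  clone-step i (pc⁺ , _) (z , s , ss , refl) (step {pc = pc} {pc′} zero o d same e) =
    (d⁺ , _) , (refl , trans s (sym (same (suc i) λ ())) , (λ _ → refl) , refl) ,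
    step zero o (trans (cong (λ q → δ leader q o (pc′ zero)) z) d)
         (λ { zero ne → contradiction refl ne
            ; (suc zero) ne → refl
            ; (suc (suc j)) ne → trans (same (suc j) λ ()) (sym (ss j)) })
         (fromEff (toEff e)) ◅ []
    where
    d⁺ : (j : Fin _) → Fin (size (Program.threads (𝒜^ _) j))
    d⁺ zero          = pc′ zero
    d⁺ (suc zero)    = pc⁺ (suc zero)
    d⁺ (suc (suc j)) = pc′ (suc j)
  clone-step i (pc⁺ , _) (z , s , ss , refl) (step {pc = pc} {pc′} (suc k) o d same e)
    with k ≟ᶠ i
  ... | no k≢i =
    (d⁺ , _) , (trans z (sym (same zero λ ())) ,
                trans s (sym (same (suc i) λ { refl → k≢i refl })) , (λ _ → refl) , refl) ,
    step (suc (suc k)) o (trans (cong (λ q → δ contributor q o (pc′ (suc k))) (ss k)) d)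
         (λ { zero ne → refl
            ; (suc zero) ne → refl
            ; (suc (suc j)) ne → trans (same (suc j) λ { refl → ne refl }) (sym (ss j)) })
         (fromEff (toEff e)) ◅ []
    where
    d⁺ : (j : Fin _) → Fin (size (Program.threads (𝒜^ _) j))
    d⁺ zero          = pc⁺ zero
    d⁺ (suc zero)    = pc⁺ (suc zero)
    d⁺ (suc (suc j)) = pc′ (suc j)
  ... | yes refl =
    (d⁺ , _) , (trans z (sym (same zero λ ())) , refl , (λ _ → refl) , refl) ,
    step {pc′ = m⁺} (suc (suc k)) o
         (trans (cong (λ q → δ contributor q o (pc′ (suc k))) (ss k)) d)
         (λ { zero ne → refl
            ; (suc zero) ne → refl
            ; (suc (suc j)) ne → trans (same (suc j) λ { refl → ne refl }) (sym (ss j)) })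
         (fromEff (toEff e)) ◅
    step (suc zero) o
         (trans (cong (λ q → δ contributor q o (pc′ (suc k))) s) d)
         (λ { zero ne → refl
            ; (suc zero) ne → contradiction refl ne
            ; (suc (suc j)) ne → refl })
         (settle (fromEff (toEff e))) ◅ []
    where
    d⁺ m⁺ : (j : Fin _) → Fin (size (Program.threads (𝒜^ _) j))
    m⁺ zero          = pc⁺ zero
    m⁺ (suc zero)    = pc⁺ (suc zero)
    m⁺ (suc (suc j)) = pc′ (suc j)
    d⁺ zero          = pc⁺ zero
    d⁺ (suc zero)    = pc′ (suc k)
    d⁺ (suc (suc j)) = pc′ (suc j)

  clone-path : ∀ {t c c′} i c⁺ → Clone {t} i c c⁺ → Reaches (𝒜^ t) c c′ →
               ∃[ d⁺ ] Clone {t} i c′ d⁺ × Reaches (𝒜^ (suc t)) c⁺ d⁺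
  clone-path i c⁺ C []       = c⁺ , C , []
  clone-path i c⁺ C (x ◅ xs) with clone-step i c⁺ C x
  ... | d⁺ , C′ , ys with clone-path i d⁺ C′ xs
  ...   | e⁺ , C″ , zs = e⁺ , C″ , ys ◅◅ zs

  -- All states of the set are occupied at once, in a single configuration. The number `t` is
  -- existential because it grows with every contributor move of the abstract path.
  Realises : Node → Set
  Realises v = ∃[ t ] ∃[ pc ] Reaches (𝒜^ t) (initial (𝒜^ t)) (pc , mem v) ×
    pc zero ≡ lead v × (∀ p → lookup (set v) p ≡ true → ∃[ i ] pc (suc i) ≡ p)

  realise : ∀ {v} → Reach v → Realises v
  realise here = 1 , _ , [] , refl , pop
    where
    pop : ∀ p → lookup (⊥ ∪｛ q⁰ contributor ｝) p ≡ true → ∃[ i ] q⁰ contributor ≡ p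
    pop p p∈ with p ≟ᶠ q⁰ contributor
    ... | yes refl = zero , refl
    ... | no  p≢   with trans (sym p∈) (trans (lookup∘update′ p≢ ⊥ true) (lookup-replicate p false))
    ...   | ()
  realise (then r (leads {q′ = q′} {a′ = a′} d e)) with realise r
  ... | t , pc , path , refl , pop =
    t , pc′ , path ◅◅ (step zero _ d same (fromEff e) ◅ []) , refl , pop
    where
    pc′ : (j : Fin (suc t)) → Fin (size (Program.threads (𝒜^ t) j))
    pc′ zero    = q′
    pc′ (suc j) = pc (suc j)

    same : ∀ j → j ≢ zero → pc′ j ≡ pc j
    same zero    ne = contradiction refl ne
    same (suc j) ne = refl
  realise (then r (contributes {S = S} {p = p} {p′ = p′} {o = o} p∈ d e)) with realise r
  ... | t , pc , path , refl , pop with pop p p∈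
  -- The clone of `i`, at contributor position zero, makes the move; the original, shifted by one
  -- position, keeps `p` occupied.
  ... | i , at-p with clone-path i (initial (𝒜^ (suc t))) (refl , refl , (λ _ → refl) , refl) path
  ... | (pc⁺ , _) , (z , s , ss , refl) , path⁺ =
    suc t , pc′ , path⁺ ◅◅ (step (suc zero) o d′ same (fromEff e) ◅ []) , z , pop′
    where
    pc′ : (j : Fin (suc (suc t))) → Fin (size (Program.threads (𝒜^ (suc t)) j))
    pc′ zero          = pc⁺ zero
    pc′ (suc zero)    = p′
    pc′ (suc (suc j)) = pc⁺ (suc (suc j))

    d′ : δ contributor (pc⁺ (suc zero)) o p′ ≡ true
    d′ = trans (cong (λ r → δ contributor r o p′) (trans s at-p)) d

    same : ∀ j → j ≢ suc zero → pc′ j ≡ pc⁺ j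
    same zero          ne = refl
    same (suc zero)    ne = contradiction refl ne
    same (suc (suc j)) ne = refl

    pop′ : ∀ r → lookup (S ∪｛ p′ ｝) r ≡ true → ∃[ j ] pc′ (suc j) ≡ r
    pop′ r r∈ with r ≟ᶠ p′
    ... | yes refl = zero , refl
    ... | no  r≢p′ with pop r (trans (sym (lookup∘update′ r≢p′ S true)) r∈)
    ...   | j , at-r = suc j , trans (ss j) at-r

  UnsafeReach : Set
  UnsafeReach = ∃[ v ] Reach v × lookup unsafe (lead v) ≡ true

-- Program logic

≡ᵇ-refl : ∀ n → (n ≡ᵇ n) ≡ true
≡ᵇ-refl zero    = refl
≡ᵇ-refl (suc n) = ≡ᵇ-refl n

≢⇒≡ᵇ-false : ∀ {m n} → m ≢ n → (m ≡ᵇ n) ≡ false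
≢⇒≡ᵇ-false {zero}  {zero}  m≢n = contradiction refl m≢n
≢⇒≡ᵇ-false {zero}  {suc n} m≢n = refl
≢⇒≡ᵇ-false {suc m} {zero}  m≢n = refl
≢⇒≡ᵇ-false {suc m} {suc n} m≢n = ≢⇒≡ᵇ-false (λ m≡n → m≢n (cong suc m≡n))

module _ {A : Set} (f : ℕ → A) (i : ℕ) (a : A) where

  update-same : ∀ {j} → j ≡ i → update f i a j ≡ a
  update-same refl rewrite ≡ᵇ-refl i = refl

  update-other : ∀ {j} → j ≢ i → update f i a j ≡ f j
  update-other j≢i rewrite ≢⇒≡ᵇ-false j≢i = refl

-- A Boolean computed from the syntax, so that for concrete commands and registers the side
-- conditions hold by `refl`.
modifies : Cmd → ℕ → Bool
modifies skip           y = false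
modifies (x ≔ e)        y = y ≡ᵇ x
modifies (A [ i ]≔ e)   y = false
modifies (c ⨾ d)        y = modifies c y ∨ modifies d y
modifies (branch e c d) y = modifies c y ∨ modifies d y
modifies (while e c)    y = modifies c y

-- Covers registers only; what happens to the arrays has to be carried in the postconditions.
Frame : Cmd → State → State → Set
Frame c s s′ = ∀ y → modifies c y ≡ false → reg s′ y ≡ reg s y

frame : ∀ {W c s s′ n} → W ⊢ c , s ⇓ s′ ⟨ n ⟩ → Frame c s s′
frame skip y k = refl
frame (assign _) y k rewrite k = refl
frame (store _) y k = refl
frame (seq p q) y k =
  trans (frame q y (∨-conicalʳ _ _ k)) (frame p y (∨-conicalˡ _ _ k))
frame (branch-true _ p) y k = frame p y (∨-conicalˡ _ _ k)
frame (branch-false _ p) y k = frame p y (∨-conicalʳ _ _ k)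
frame (while-true _ p q) y k = trans (frame q y k) (frame p y k)
frame (while-false _) y k = refl

infix 9 _⟪_⟫

_⟪_⟫ : State → ℕ × ℕ → State
s ⟪ x , v ⟫ = ⟨ update (reg s) x v , arr s ⟩

-- Truncated subtraction acts as the comparison: the guard is nonzero exactly while the counter is
-- below the bound.
For : ℕ → ℕ → Cmd → Cmd
For x y c = x ≔ con 0 ⨾ while (var y ⊖ var x) (c ⨾ x ≔ var x ⊕ con 1)

module Hoare (W : ℕ) where

  Run : Cmd → State → ℕ → (State → Set) → Set
  Run c s n Q = ∃[ s′ ] ∃[ m ] (W ⊢ c , s ⇓ s′ ⟨ m ⟩) × m ≤ n × Q s′

  -- Besides the consequence rule this supplies the frame of the command, so that postconditions
  -- need not list the registers left alone.
  run-weaken : ∀ {c s n n′ Q Q′} → n ≤ n′ → (∀ s′ → Frame c s s′ → Q s′ → Q′ s′) →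
               Run c s n Q → Run c s n′ Q′
  run-weaken n≤n′ imp (s′ , m , p , m≤n , q) =
    s′ , m , p , ≤-trans m≤n n≤n′ , imp s′ (frame p) q

  run-skip : ∀ {s Q} → Q s → Run skip s 1 Q
  run-skip q = _ , _ , skip , ≤-refl , q

  run-assign : ∀ {x e s Q} → ⟦ e ⟧ s ≤ W → Q (s ⟪ x , ⟦ e ⟧ s ⟫) →
               Run (x ≔ e) s (1 + cost e) Q
  run-assign b q = _ , _ , assign b , ≤-refl , q

  run-store : ∀ {A i e s Q} → ⟦ e ⟧ s ≤ W →
              Q ⟨ reg s , update (arr s) A (update (arr s A) (⟦ i ⟧ s) (⟦ e ⟧ s)) ⟩ →
              Run (A [ i ]≔ e) s (1 + cost i + cost e) Q
  run-store b q = _ , _ , store b , ≤-refl , q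

  run-seq : ∀ {c d s m n Q} → Run c s m (λ s′ → Run d s′ n Q) → Run (c ⨾ d) s (m + n) Q
  run-seq (s′ , k , p , k≤m , (s″ , l , q , l≤n , r)) =
    s″ , _ , seq p q , +-mono-≤ k≤m l≤n , r

  run-branch : ∀ {e c d s n Q} →
               (⟦ e ⟧ s ≢ 0 → Run c s n Q) → (⟦ e ⟧ s ≡ 0 → Run d s n Q) →
               Run (branch e c d) s (1 + cost e + n) Q
  run-branch {e} {s = s} t f with ⟦ e ⟧ s ≟ 0
  ... | yes z with f z
  ...   | s′ , m , p , m≤n , q =
    s′ , _ , branch-false z p , +-monoʳ-≤ (1 + cost e) m≤n , q
  run-branch {e} {s = s} t f | no z with t z
  ...   | s′ , m , p , m≤n , q =
    s′ , _ , branch-true z p , +-monoʳ-≤ (1 + cost e) m≤n , q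

  -- Each iteration increments the index of the invariant, which cannot exceed N.
  run-while : ∀ {e c n N} (P : ℕ → State → Set) →
    (∀ h s → P h s → ⟦ e ⟧ s ≢ 0 → h < N × Run c s n (P (suc h))) →
    ∀ g h s → h + g ≡ N → P h s →
    Run (while e c) s (1 + cost e + g * (1 + cost e + n))
        (λ s′ → ⟦ e ⟧ s′ ≡ 0 × ∃[ i ] P i s′)
  run-while {e} {c} {n} {N} P body g h s eq p with ⟦ e ⟧ s ≟ 0
  ... | yes z = s , _ , while-false z , m≤m+n _ _ , z , h , p
  ... | no  z with body h s p z
  run-while P body zero h s eq p | no z | h<N , _ =
    contradiction (trans (sym (+-identityʳ h)) eq) (<⇒≢ h<N)
  run-while {e} {c} {n} P body (suc g) h s eq p | no z | h<N , (s₁ , k , r , k≤n , p₁)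
    with run-while P body g (suc h) s₁ (trans (sym (+-suc h g)) eq) p₁
  ... | s₂ , l , w , l≤ , q =
    s₂ , _ , while-true z r w ,
    ≤-trans (+-mono-≤ (+-monoʳ-≤ (1 + cost e) k≤n) l≤)
            (≤-reflexive (shift (1 + cost e) n (g * (1 + cost e + n)))) , q
    where
    shift : ∀ a n r → a + n + (a + r) ≡ a + (a + n + r)
    shift = solve-∀

  -- Since `1 ≤ n`, the initialisation (2) and the final test (4) can be charged to the iterations,
  -- which keeps the cost a multiple of `n`; together with a test (4) and an increment (4) per
  -- iteration this gives 14. The counter ends at `n`, hence `n ≤ W`.
  run-for : ∀ {x y c n k} (P : ℕ → State → Set) →
    modifies (For x y c) y ≡ false → modifies c x ≡ false →
    1 ≤ n → n ≤ W → ∀ {s} → reg s y ≡ n →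
    P 0 (s ⟪ x , 0 ⟫) →
    (∀ i s₁ → i < n → reg s₁ x ≡ i → Frame (For x y c) s s₁ → P i s₁ →
      Run c s₁ k (λ s₂ → P (suc i) (s₂ ⟪ x , suc i ⟫))) →
    Run (For x y c) s (n * (14 + k)) (P n)
  run-for {x} {y} {c} {n} {k} P y-kept x-kept 1≤n n≤W {s} y≡n p₀ body =
    run-weaken cost≤ (λ s′ _ q → q)
      (run-seq (run-assign z≤n
        (run-weaken ≤-refl exit
          (run-while Q iteration n 0 (s ⟪ x , 0 ⟫) refl
            (z≤n , update-same (reg s) x 0 refl , start , p₀)))))
    where
    Q : ℕ → State → Set
    Q i s₁ = i ≤ n × reg s₁ x ≡ i × Frame (For x y c) s s₁ × P i s₁

    start : Frame (For x y c) s (s ⟪ x , 0 ⟫)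
    start z kz rewrite ∨-conicalˡ (z ≡ᵇ x) _ kz = refl

    y≡ : ∀ {s₁} → Frame (For x y c) s s₁ → reg s₁ y ≡ n
    y≡ fr = trans (fr y y-kept) y≡n

    iteration : ∀ i s₁ → Q i s₁ → reg s₁ y ∸ reg s₁ x ≢ 0 →
           i < n × Run (c ⨾ x ≔ var x ⊕ con 1) s₁ (k + 4) (Q (suc i))
    iteration i s₁ (i≤n , x≡i , fr , p) ne = i<n ,
      run-seq (run-weaken ≤-refl next (body i s₁ i<n x≡i fr p))
      where
      i<n : i < n
      i<n = ≤∧≢⇒< i≤n λ i≡n →
        ne (trans (cong₂ _∸_ (y≡ {s₁} fr) (trans x≡i i≡n)) (n∸n≡0 n))

      next : ∀ s₂ → Frame c s₁ s₂ → P (suc i) (s₂ ⟪ x , suc i ⟫) →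
             Run (x ≔ var x ⊕ con 1) s₂ 4 (Q (suc i))
      -- The invariant `p₂` speaks of a state containing `suc i`, the assignment stores
      -- `reg s₂ x + 1`. Rewriting the index makes the two states the same term.
      next s₂ fr₂ p₂ rewrite sym (trans (+-comm (reg s₂ x) 1) (cong suc (trans (fr₂ x x-kept) x≡i))) =
        run-assign (subst (_≤ W) (sym v) (≤-trans i<n n≤W))
          (subst (_≤ n) (sym v) i<n , update-same (reg s₂) x _ refl , fr′ , p₂)
        where
        v : reg s₂ x + 1 ≡ suc i
        v = trans (+-comm (reg s₂ x) 1) (cong suc (trans (fr₂ x x-kept) x≡i))

        fr′ : Frame (For x y c) s (s₂ ⟪ x , reg s₂ x + 1 ⟫)
        fr′ z kz rewrite ∨-conicalˡ (z ≡ᵇ x) _ kz =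
          trans (fr₂ z (∨-conicalˡ _ _ (∨-conicalʳ (z ≡ᵇ x) _ kz))) (fr z kz)

    exit : ∀ s′ → Frame (while (var y ⊖ var x) (c ⨾ x ≔ var x ⊕ con 1)) (s ⟪ x , 0 ⟫) s′ →
           (reg s′ y ∸ reg s′ x ≡ 0 × ∃[ i ] Q i s′) → P n s′
    exit s′ _ (z , i , i≤n , x≡i , fr , p) =
      subst (λ i → P i s′)
        (≤-antisym i≤n (m∸n≡0⇒m≤n (trans (cong₂ _∸_ (sym (y≡ {s′} fr)) (sym x≡i)) z))) p

    cost≤ : 2 + (4 + n * (4 + (k + 4))) ≤ n * (14 + k)
    cost≤ = ≤-trans (+-monoˡ-≤ (n * (4 + (k + 4))) (*-monoˡ-≤ 6 1≤n))
                    (≤-reflexive (lem n k))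
      where
      lem : ∀ n k → n * 6 + n * (4 + (k + 4)) ≡ n * (14 + k)
      lem = solve-∀

-- Numbering

digits-injective : ∀ n x y {i j} → i < n → j < n → x * n + i ≡ y * n + j → x ≡ y × i ≡ j
digits-injective n zero    zero    i<n j<n eq = refl , eq
digits-injective n zero    (suc y) {i} {j} i<n j<n eq =
  contradiction eq (<⇒≢ (<-≤-trans i<n (≤-trans (m≤m+n n _) (m≤m+n _ j))))
digits-injective n (suc x) zero    {i} {j} i<n j<n eq =
  contradiction (sym eq) (<⇒≢ (<-≤-trans j<n (≤-trans (m≤m+n n _) (m≤m+n _ i))))
digits-injective n (suc x) (suc y) {i} {j} i<n j<n eq
  with digits-injective n x y i<n j<n
         (+-cancelˡ-≡ n _ _ (trans (sym (+-assoc n (x * n) i)) (trans eq (+-assoc n (y * n) j))))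
... | x≡y , i≡j = cong suc x≡y , i≡j

digits-bound : ∀ {m n x i} → x < m → i < n → x * n + i < m * n
digits-bound {m} {n} {x} {i} x<m i<n = begin-strict
  x * n + i   <⟨ +-monoʳ-< (x * n) i<n ⟩
  x * n + n   ≡⟨ +-comm (x * n) n ⟩
  suc x * n   ≤⟨ *-monoˡ-≤ n x<m ⟩
  m * n       ∎
  where open ≤-Reasoning

-- On the 0-1 table of visited nodes this counts the marks.
sum< : (ℕ → ℕ) → ℕ → ℕ
sum< f zero    = 0
sum< f (suc n) = f n + sum< f n

sum<-bound : ∀ {f} n → (∀ i → f i ≤ 1) → sum< f n ≤ n
sum<-bound zero    f≤1 = z≤n
sum<-bound (suc n) f≤1 = +-mono-≤ (f≤1 n) (sum<-bound n f≤1)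

sum<-cong : ∀ {f g} n → (∀ i → i < n → f i ≡ g i) → sum< f n ≡ sum< g n
sum<-cong zero    f≡g = refl
sum<-cong (suc n) f≡g = cong₂ _+_ (f≡g n ≤-refl) (sum<-cong n λ i i<n → f≡g i (m<n⇒m<1+n i<n))

sum<-update : ∀ {f i} n → i < n → f i ≡ 0 → sum< (update f i 1) n ≡ suc (sum< f n)
sum<-update {f} {i} (suc n) i<1+n fi≡0 with m<1+n⇒m<n∨m≡n i<1+n
... | inj₁ i<n = trans
  (cong₂ _+_ (update-other f i 1 (λ { refl → <-irrefl refl i<n })) (sum<-update n i<n fi≡0))
  (+-suc (f n) _)
... | inj₂ refl = cong₂ _+_ (trans (update-same f n 1 refl) (cong suc (sym fi≡0)))
  (sum<-cong n λ j j<n → update-other f n 1 (<⇒≢ j<n))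

sum<-zero : ∀ n → sum< (λ _ → 0) n ≡ 0
sum<-zero zero    = refl
sum<-zero (suc n) = sum<-zero n

-- The binary number whose most significant digit is `f 0`; the recursion repeats the update of
-- `rIndex` in `pushBit`.
horner : (ℕ → ℕ) → ℕ → ℕ
horner f zero    = 0
horner f (suc n) = horner f n + horner f n + f n

double : ∀ h b → h + h + b ≡ h * 2 + b
double = solve-∀

horner<2^ : ∀ {f} n → (∀ i → f i ≤ 1) → horner f n < 2 ^ n
horner<2^         zero    f≤1 = s≤s z≤n
horner<2^ {f} (suc n) f≤1 = subst₂ _<_ (sym (double (horner f n) (f n))) (*-comm (2 ^ n) 2)
  (digits-bound (horner<2^ n f≤1) (s≤s (f≤1 n)))

horner-injective : ∀ {f g} n → (∀ i → f i ≤ 1) → (∀ i → g i ≤ 1) →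
                   horner f n ≡ horner g n → ∀ i → i < n → f i ≡ g i
horner-injective {f} {g} (suc n) f≤1 g≤1 eq i i<1+n
  with digits-injective 2 (horner f n) (horner g n) (s≤s (f≤1 n)) (s≤s (g≤1 n))
         (trans (sym (double (horner f n) (f n))) (trans eq (double (horner g n) (g n))))
... | eq′ , fn≡gn with m<1+n⇒m<n∨m≡n i<1+n
...   | inj₁ i<n  = horner-injective n f≤1 g≤1 eq′ i i<n
...   | inj₂ refl = fn≡gn

bit : Bool → ℕ
bit b = if b then 1 else 0

bit-injective : ∀ b c → bit b ≡ bit c → b ≡ c
bit-injective true  true  eq = refl
bit-injective false false eq = refl

bit≢0 : ∀ {b} → bit b ≢ 0 → b ≡ true
bit≢0 {true}  ne = refl
bit≢0 {false} ne = contradiction refl ne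

module _ {n} (f : Fin n → Bool) where

  table-toℕ : ∀ i → table f (toℕ i) ≡ bit (f i)
  table-toℕ i with toℕ i <? n
  ... | yes i<n = cong (λ j → bit (f j)) (fromℕ<-toℕ i i<n)
  ... | no  i≮n = contradiction (toℕ<n i) i≮n

  table≤1 : ∀ i → table f i ≤ 1
  table≤1 i with i <? n
  ... | no  _   = z≤n
  ... | yes i<n with f (fromℕ< i<n)
  ...   | true  = ≤-refl
  ...   | false = z≤n

table-⊥ : ∀ {n} i → table (lookup {n = n} ⊥) i ≡ 0
table-⊥ {n} i with i <? n
... | no  _   = refl
... | yes i<n = cong bit (lookup-replicate (fromℕ< i<n) false)

tables-injective : ∀ {n} (S T : Subset n) →
  (∀ i → i < n → table (lookup S) i ≡ table (lookup T) i) → S ≡ T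
tables-injective S T eq = begin
  S                    ≡⟨ tabulate∘lookup S ⟨
  tabulate (lookup S)  ≡⟨ tabulate-cong (λ i → bit-injective _ _
    (trans (sym (table-toℕ (lookup S) i)) (trans (eq (toℕ i) (toℕ<n i)) (table-toℕ (lookup T) i)))) ⟩
  tabulate (lookup T)  ≡⟨ tabulate∘lookup T ⟩
  T                    ∎
  where open ≡-Reasoning

-- The membership bit of j in S ∪ {p}, given the bit b of j in S: the distance
-- of j and p, as a sum of truncated differences, vanishes only for j = p.
insert : ℕ → ℕ → ℕ → ℕ
insert p b j = 1 ∸ (1 ∸ b) * ((j ∸ p) + (p ∸ j))

insert-self : ∀ {p b} → insert p b p ≡ 1
insert-self {p} {b} rewrite n∸n≡0 p | *-zeroʳ (1 ∸ b) = refl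

-- For `b = 1` the product vanishes; for `b = 0` it is the distance, at least 1, and the outer
-- difference is cut off at 0. `p` may exceed every state, as it does for leader moves.
insert-other : ∀ {p b j} → j ≢ p → b ≤ 1 → insert p b j ≡ b
insert-other {b = suc zero} j≢p _ = refl
insert-other {b = suc (suc b)} j≢p (s≤s ())
insert-other {p} {zero} {j} j≢p _ = m≤n⇒m∸n≡0 (≤-trans (dist j≢p) (≤-reflexive (sym (+-identityʳ _))))
  where
  dist : ∀ {j p} → j ≢ p → 1 ≤ (j ∸ p) + (p ∸ j)
  dist {zero}  {zero}  ne = contradiction refl ne
  dist {zero}  {suc p} ne = s≤s z≤n
  dist {suc j} {zero}  ne = s≤s z≤n
  dist {suc j} {suc p} ne = dist λ eq → ne (cong suc eq)

insert-table : ∀ {n} (S : Subset n) p j → j < n →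
  insert (toℕ p) (table (lookup S) j) j ≡ table (lookup (S ⟨ p ⟩≔ true)) j
insert-table {n} S p j j<n with j ≟ toℕ p
... | yes refl = trans (insert-self {toℕ p} {table (lookup S) (toℕ p)})
  (sym (trans (table-toℕ (lookup (S ⟨ p ⟩≔ true)) p) (cong bit (lookup∘update p S true))))
... | no j≢p = trans (insert-other j≢p (table≤1 (lookup S) j)) (subst P (toℕ-fromℕ< j<n) at)
  where
  P : ℕ → Set
  P i = table (lookup S) i ≡ table (lookup (S ⟨ p ⟩≔ true)) i

  r = fromℕ< j<n

  at : P (toℕ r)
  at = trans (table-toℕ (lookup S) r) (trans
    (cong bit (sym (lookup∘update′ (λ { refl → j≢p (sym (toℕ-fromℕ< j<n)) }) S true)))
    (sym (table-toℕ (lookup (S ⟨ p ⟩≔ true)) r)))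

code : ∀ {d} → Maybe (Op (Fin d)) → ℕ
code         nothing       = 0
code         (just (wr a)) = 1 + toℕ a
code {d = d} (just (rd a)) = 1 + d + toℕ a

-- Phrased as an existence so that matching on it turns an arbitrary label into `label k`, the form
-- in which the transition tables are laid out.
code-label : ∀ {d} (o : Maybe (Op (Fin d))) →
             ∃[ k ] label k ≡ o × toℕ k ≡ code o
code-label         nothing       = zero , refl , refl
code-label {d = d} (just (wr a)) = suc (a ↑ˡ d) ,
  cong (λ z → just ([ wr , rd ]′ z)) (splitAt-↑ˡ d a d) , cong suc (toℕ-↑ˡ a d)
code-label {d = d} (just (rd a)) = suc (d ↑ʳ a) ,
  cong (λ z → just ([ wr , rd ]′ z)) (splitAt-↑ʳ d d a) , cong suc (toℕ-↑ʳ d a)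

transitions-at : ∀ {d} (P : NFA (Op (Fin d))) q o q′ →
  table (transitions P) ((code o * size P + toℕ q) * size P + toℕ q′) ≡ bit (δ P q o q′)
transitions-at {d} P q o q′ with code-label o
... | k , refl , eq = trans (cong (table (transitions P)) index)
  (trans (table-toℕ (transitions P) (combine (combine k q) q′)) (cong bit entry))
  where
  m = size P

  index : (code o * m + toℕ q) * m + toℕ q′ ≡ toℕ (combine (combine k q) q′)
  index = sym (begin
    toℕ (combine (combine k q) q′)     ≡⟨ toℕ-combine (combine k q) q′ ⟩
    m * toℕ (combine k q) + toℕ q′     ≡⟨ cong (_+ toℕ q′) (*-comm m _) ⟩
    toℕ (combine k q) * m + toℕ q′     ≡⟨ cong (λ z → z * m + toℕ q′) (toℕ-combine k q) ⟩
    (m * toℕ k + toℕ q) * m + toℕ q′   ≡⟨ cong (λ z → (z + toℕ q) * m + toℕ q′) (*-comm m _) ⟩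
    (toℕ k * m + toℕ q) * m + toℕ q′   ≡⟨ cong (λ z → (z * m + toℕ q) * m + toℕ q′) eq ⟩
    (code o * m + toℕ q) * m + toℕ q′  ∎)
    where open ≡-Reasoning

  entry : transitions P (combine (combine k q) q′) ≡ δ P q (label k) q′
  entry = trans
    (cong (λ z → δ P (proj₂ (remQuot {1 + (d + d)} m (proj₁ z)))
                     (label (proj₁ (remQuot {1 + (d + d)} m (proj₁ z)))) (proj₂ z))
          (remQuot-combine (combine k q) q′))
    (cong (λ z → δ P (proj₂ z) (label (proj₁ z)) q′) (remQuot-combine k q))

-- The search

-- Registers 0 to 5 and arrays 0 to 2 hold the input.
rD rL rC rA⁰ rQ⁰ rP⁰ rHead rTail rLead rMem rLead′ rMem′ rNew rPos rIndex rCode rOld rFound rBit : ℕ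
rD     = 0
rL     = 1
rC     = 2
rA⁰    = 3
rQ⁰    = 4
rP⁰    = 5
rHead  = 6
rTail  = 7
rLead  = 8
rMem   = 9
rLead′ = 10
rMem′  = 11
rNew   = 12
rPos   = 13
rIndex = 14
rCode  = 15
rOld   = 16
rFound = 17
rBit   = 18

-- Node h of the queue is in aLead at h, in aMem at h, and in aRow from h * 𝙲 on;
-- aSet holds the set of the node being processed.
aδL aδC aBad aVisited aLead aMem aRow aSet : ℕ
aδL      = 0
aδC      = 1
aBad     = 2
aVisited = 3
aLead    = 4
aMem     = 5
aRow     = 6
aSet     = 7

pushBit enqueue push tryLeader leaderMoves tryContributor tryContributors contributorMoves : Cmd
load process search : Cmd

pushBit =
  rBit ≔ con 1 ⊖ (con 1 ⊖ aSet ! var rPos) ⊗ ((var rPos ⊖ var rNew) ⊕ (var rNew ⊖ var rPos)) ⨾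
  aRow [ var rTail ⊗ var rC ⊕ var rPos ]≔ var rBit ⨾
  rIndex ≔ var rIndex ⊕ var rIndex ⊕ var rBit

enqueue =
  aVisited [ var rIndex ]≔ con 1 ⨾
  aLead [ var rTail ]≔ var rLead′ ⨾
  aMem [ var rTail ]≔ var rMem′ ⨾
  rTail ≔ var rTail ⊕ con 1

-- The row is written at the tail while the number is being computed, before it is known whether the
-- node is new. For an old node the tail stays put, and the next push overwrites the row.
push =
  rIndex ≔ con 0 ⨾
  For rPos rC pushBit ⨾
  rIndex ≔ (var rIndex ⊗ var rL ⊕ var rLead′) ⊗ var rD ⊕ var rMem′ ⨾
  branch (aVisited ! var rIndex) skip enqueue

tryLeader =
  branch (aδL ! ((var rCode ⊗ var rL ⊕ var rLead) ⊗ var rL ⊕ var rLead′)) push skip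

-- A leader move adds no contributor state: 𝙲 is not the number of one.
leaderMoves = rNew ≔ var rC ⨾ For rLead′ rL tryLeader

tryContributor =
  branch (aδC ! ((var rCode ⊗ var rC ⊕ var rOld) ⊗ var rC ⊕ var rNew)) push skip

tryContributors = branch (aSet ! var rOld) (For rNew rC tryContributor) skip

contributorMoves = rLead′ ≔ var rLead ⨾ For rOld rC tryContributors

-- Runs through the labels enabled at the current memory value only: ε, the read of this value, and
-- all writes, where the loop counter is both the written value and the new memory. This makes
-- `𝙳 + 2` rounds.
forEffects : Cmd → Cmd
forEffects c =
  rCode ≔ con 0 ⨾
  rMem′ ≔ var rMem ⨾
  c ⨾
  rCode ≔ con 1 ⊕ var rD ⊕ var rMem ⨾
  rMem′ ≔ var rMem ⨾
  c ⨾
  For rMem′ rD (rCode ≔ con 1 ⊕ var rMem′ ⨾ c)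

load =
  rLead ≔ aLead ! var rHead ⨾
  rMem ≔ aMem ! var rHead ⨾
  For rPos rC (aSet [ var rPos ]≔ aRow ! (var rHead ⊗ var rC ⊕ var rPos))

process =
  load ⨾
  rHead ≔ var rHead ⊕ con 1 ⨾
  branch (aBad ! var rLead) (rFound ≔ con 1) skip ⨾
  forEffects leaderMoves ⨾
  forEffects contributorMoves

search =
  rLead′ ≔ var rQ⁰ ⨾
  rMem′ ≔ var rA⁰ ⨾
  rNew ≔ var rP⁰ ⨾
  push ⨾
  while (var rTail ⊖ var rHead) process ⨾
  -- Register 0 held `𝙳` up to here and now takes the answer.
  branch (var rFound) (0 ≔ con 1) (0 ≔ con 0)

-- Arithmetic of the cost bounds

≤-*ˡ : ∀ {m n} → 1 ≤ m → n ≤ m * n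
≤-*ˡ {suc m} {n} _ = m≤m+n n (m * n)

≤-*ʳ : ∀ {m n} → 1 ≤ n → m ≤ m * n
≤-*ʳ {m} {n} 1≤n = subst (m ≤_) (*-comm n m) (≤-*ˡ 1≤n)

-- Costs are kept in the form of a product of positive parameters times a numeral,
-- into which summands of lower order are absorbed.
absorb : ∀ a k b {K n} → 1 ≤ n → T (a + k + b ≤ᵇ K) → a + (n * k + b) ≤ n * K
absorb a k b {K} {suc n} 1≤n le = begin
  a + (suc n * k + b)              ≤⟨ +-mono-≤ (m≤m+n a (n * a)) (+-monoʳ-≤ (suc n * k) (m≤m+n b (n * b))) ⟩
  suc n * a + (suc n * k + suc n * b) ≡⟨ cong (suc n * a +_) (*-distribˡ-+ (suc n) k b) ⟨
  suc n * a + suc n * (k + b)      ≡⟨ *-distribˡ-+ (suc n) a (k + b) ⟨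
  suc n * (a + (k + b))            ≡⟨ cong (suc n *_) (+-assoc a k b) ⟨
  suc n * (a + k + b)              ≤⟨ *-monoʳ-≤ (suc n) (≤ᵇ⇒≤ _ _ le) ⟩
  suc n * K                        ∎
  where open ≤-Reasoning

-- The condition on the numerals is a Boolean test under `T`, so that it is settled by evaluation.
absorb₂ : ∀ a b k {K n m} → 1 ≤ n → 1 ≤ m → T (a + (b + k) ≤ᵇ K) →
          a + n * (b + m * k) ≤ n * m * K
absorb₂ a b k {K} {suc n} {suc m} 1≤n 1≤m le = begin
  a + N * (b + M * k)          ≤⟨ +-mono-≤ (m≤m+n a _) (*-monoʳ-≤ N (+-monoˡ-≤ (M * k) (m≤m+n b (m * b)))) ⟩
  N * M * a + N * (M * b + M * k)  ≡⟨ collect N M a b k ⟩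
  N * M * (a + (b + k))        ≤⟨ *-monoʳ-≤ (N * M) (≤ᵇ⇒≤ _ _ le) ⟩
  N * M * K                    ∎
  where
  open ≤-Reasoning
  N = suc n
  M = suc m

  collect : ∀ n m a b k → n * m * a + n * (m * b + m * k) ≡ n * m * (a + (b + k))
  collect = solve-∀

-- `30 + 3 * κ` is the left-hand side at `n = m = 1`. The excess of the right-hand side is a
-- polynomial in the predecessors with natural coefficients; adding it explicitly leaves an identity
-- for the ring solver.
effects-cost : ∀ κ {n m} → 1 ≤ n → 1 ≤ m →
  2 + (2 + (m * κ + (6 + (2 + (m * κ + n * (14 + (4 + m * κ))))))) ≤ n * m * (30 + 3 * κ)
effects-cost κ {suc n} {suc m} 1≤n 1≤m = ≤-trans
  (m≤m+n _ (12 * (n + m + n * m) + 2 * κ * (n * suc m) + 18 * (m * suc n)))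
  (≤-reflexive (collect n m κ))
  where
  collect : ∀ n m κ →
    2 + (2 + (suc m * κ + (6 + (2 + (suc m * κ + suc n * (14 + (4 + suc m * κ))))))) +
    (12 * (n + m + n * m) + 2 * κ * (n * suc m) + 18 * (m * suc n)) ≡
    suc n * suc m * (30 + 3 * κ)
  collect = solve-∀

-- The numerals of the moves come from `effects-cost`: `321 = 30 + 3 * 97` for the leader and
-- `372 = 30 + 3 * 114` for the contributors.
process-cost : ∀ {d l c} → 1 ≤ d → 1 ≤ l → 1 ≤ c →
  3 + (3 + c * 22) + (4 + (5 + (d * (l * c) * 321 + d * (c * (c * c)) * 372))) ≤
  d * (l * (c * (c * c))) * 730
process-cost {d} {l} {c} 1≤d 1≤l 1≤c = begin
  3 + (3 + c * 22) + (4 + (5 + (d * (l * c) * 321 + d * (c * (c * c)) * 372)))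
    ≡⟨ regroup (d * (l * c)) (d * (c * (c * c))) c ⟩
  15 + c * 22 + d * (l * c) * 321 + d * (c * (c * c)) * 372
    ≤⟨ +-mono-≤ (+-mono-≤ (+-mono-≤ (*-monoˡ-≤ 15 1≤u) (*-monoˡ-≤ 22 c≤u))
         (*-monoˡ-≤ 321 (*-monoʳ-≤ d (*-monoʳ-≤ l c≤c³))))
         (*-monoˡ-≤ 372 (*-monoʳ-≤ d (≤-*ˡ 1≤l))) ⟩
  u * 15 + u * 22 + u * 321 + u * 372
    ≡⟨ total u ⟩
  u * 730 ∎
  where
  open ≤-Reasoning
  u = d * (l * (c * (c * c)))

  c≤c³ : c ≤ c * (c * c)
  c≤c³ = ≤-*ʳ (*-mono-≤ 1≤c 1≤c)

  c≤u : c ≤ u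
  c≤u = ≤-trans c≤c³ (≤-trans (≤-*ˡ 1≤l) (≤-*ˡ 1≤d))

  1≤u : 1 ≤ u
  1≤u = ≤-trans 1≤c c≤u

  regroup : ∀ x y c → 3 + (3 + c * 22) + (4 + (5 + (x * 321 + y * 372))) ≡
                      15 + c * 22 + x * 321 + y * 372
  regroup = solve-∀

  total : ∀ u → u * 15 + u * 22 + u * 321 + u * 372 ≡ u * 730
  total = solve-∀

-- 818 is the left-hand side with all three arguments equal to 1.
search-cost : ∀ {n u c} → 1 ≤ n → 1 ≤ u → c ≤ u →
  2 + (2 + (2 + (c * 70 + (4 + n * (4 + u * 730) + 4)))) ≤ n * u * 818
search-cost {suc n} {suc u} {c} _ _ c≤u = begin
  2 + (2 + (2 + (c * 70 + (4 + suc n * (4 + suc u * 730) + 4))))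
    ≤⟨ +-monoʳ-≤ 6 (+-monoˡ-≤ _ (*-monoˡ-≤ 70 c≤u)) ⟩
  6 + (suc u * 70 + (4 + suc n * (4 + suc u * 730) + 4))
    ≤⟨ m≤m+n _ (14 * (n + u + n * u) + 70 * (n * suc u) + 4 * (u * suc n)) ⟩
  6 + (suc u * 70 + (4 + suc n * (4 + suc u * 730) + 4)) +
    (14 * (n + u + n * u) + 70 * (n * suc u) + 4 * (u * suc n))
    ≡⟨ collect n u ⟩
  suc n * suc u * 818 ∎
  where
  open ≤-Reasoning

  collect : ∀ n u → 6 + (suc u * 70 + (4 + suc n * (4 + suc u * 730) + 4)) +
    (14 * (n + u + n * u) + 70 * (n * suc u) + 4 * (u * suc n)) ≡ suc n * suc u * 818
  collect = solve-∀

-- Node numbers and the queue invariant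

module Correctness (I : Instance) where
  open Instance I
  open Abstraction I

  bits : Node → ℕ → ℕ
  bits v = table (lookup (set v))

  index : Node → ℕ
  index v = (horner (bits v) 𝙲 * 𝙻 + toℕ (lead v)) * 𝙳 + toℕ (mem v)

  capacity : ℕ
  capacity = 2 ^ 𝙲 * 𝙻 * 𝙳

  bits≤1 : ∀ v j → bits v j ≤ 1
  bits≤1 v = table≤1 (lookup (set v))

  index<capacity : ∀ v → index v < capacity
  index<capacity v = digits-bound (digits-bound (horner<2^ 𝙲 (bits≤1 v)) (toℕ<n (lead v))) (toℕ<n (mem v))

  node-ext : ∀ {v w} → lead v ≡ lead w → mem v ≡ mem w → (∀ j → j < 𝙲 → bits v j ≡ bits w j) → v ≡ w
  node-ext {node q a S} {node _ _ T} refl refl eq = cong (node q a) (tables-injective S T eq)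

  index-injective : ∀ v w → index v ≡ index w → v ≡ w
  index-injective v w eq with digits-injective 𝙳 _ _ (toℕ<n (mem v)) (toℕ<n (mem w)) eq
  ... | eq₁ , a≡ with digits-injective 𝙻 _ _ (toℕ<n (lead v)) (toℕ<n (lead w)) eq₁
  ...   | eq₂ , q≡ = node-ext (toℕ-injective q≡) (toℕ-injective a≡)
                       (horner-injective 𝙲 (bits≤1 v) (bits≤1 w) eq₂)

  Stored : (ql al rl : ℕ → ℕ) → ℕ → Node → Set
  Stored ql al rl i v = ql i ≡ toℕ (lead v) × al i ≡ toℕ (mem v) ×
    (∀ j → j < 𝙲 → rl (i * 𝙲 + j) ≡ bits v j)

  stored-unique : ∀ {ql al rl i} v w → Stored ql al rl i v → Stored ql al rl i w → v ≡ w
  stored-unique v w (q , a , r) (q′ , a′ , r′) =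
    node-ext (toℕ-injective (trans (sym q) q′)) (toℕ-injective (trans (sym a) a′))
      (λ j j<C → trans (sym (r j j<C)) (r′ j j<C))

  Visited : (ℕ → ℕ) → Node → Set
  Visited vis v = vis (index v) ≢ 0

  visited-new : ∀ vis w {x} → x ≡ index w → Visited (update vis x 1) w
  visited-new vis w refl eq = contradiction (trans (sym (update-same vis (index w) 1 refl)) eq) λ ()

  visited-mono : ∀ vis x v → Visited vis v → Visited (update vis x 1) v
  visited-mono vis x v vs with index v ≟ x
  ... | yes eq = λ z → contradiction (trans (sym (update-same vis x 1 eq)) z) λ ()
  ... | no  ne = λ z → vs (trans (sym (update-other vis x 1 ne)) z)

  Closed : (ℕ → ℕ) → ℕ → Node → Set
  Closed vis f v = (∀ w → v ⟶ w → Visited vis w) × (lookup unsafe (lead v) ≡ true → f ≢ 0)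

  -- The queue occupies the positions below t; those below h have been dequeued
  -- and, unless still in X, completely processed.
  record Queue (X : Node → Set) (h t f : ℕ) (vis ql al rl : ℕ → ℕ) : Set where
    field
      ordered : h ≤ t
      counted : sum< vis capacity ≡ t
      binary  : ∀ i → vis i ≤ 1
      pending : ∀ i → h ≤ i → i < t → ∃[ v ] Stored ql al rl i v × Visited vis v
      sound   : ∀ v → Visited vis v → Reach v
      handled : ∀ v → Visited vis v →
                (∃[ i ] h ≤ i × i < t × Stored ql al rl i v) ⊎ Closed vis f v ⊎ X v
      found   : f ≢ 0 → UnsafeReach

  open Queue

  module _ {X h t f vis ql al rl} (Q : Queue X h t f vis ql al rl) where

    -- The tail counts the marks, and the table has `capacity` slots holding at most 1 each. This
    -- bounds the iterations of the main loop as well as the values of `rHead` and `rTail`.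
    bounded : t ≤ capacity
    bounded = subst (_≤ capacity) (counted Q) (sum<-bound capacity (binary Q))

    -- Row `t` lies behind the queue, and by uniqueness of digits in base `𝙲` it overlaps no earlier
    -- row.
    queue-write : ∀ {x y j} → x ≡ t * 𝙲 + j → j < 𝙲 → Queue X h t f vis ql al (update rl x y)
    queue-write {x} {y} {j} refl j<C = record
      { ordered = ordered Q
      ; counted = counted Q
      ; binary  = binary Q
      ; sound   = sound Q
      ; found   = found Q
      ; pending = λ i h≤i i<t → let v , st , vs = pending Q i h≤i i<t in v , keep v i<t st , vs
      ; handled = λ v vs → map₁ (λ (i , h≤i , i<t , st) → i , h≤i , i<t , keep v i<t st)
                             (handled Q v vs)
      }
      where
      keep : ∀ {i} v → i < t → Stored ql al rl i v → Stored ql al (update rl x y) i v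
      keep v i<t (q , a , r) = q , a , λ j′ j′<C → trans
        (update-other rl x y λ eq →
          <⇒≢ i<t (proj₁ (digits-injective 𝙲 _ _ j′<C j<C eq)))
        (r j′ j′<C)

    -- Injectivity of `index` enters here: the slot belongs to `w` alone, so marking it makes no
    -- other node count as visited.
    queue-add : ∀ w {x q a} → x ≡ index w → q ≡ toℕ (lead w) → a ≡ toℕ (mem w) → Reach w →
      vis x ≡ 0 → (∀ j → j < 𝙲 → rl (t * 𝙲 + j) ≡ bits w j) →
      Queue X h (t + 1) f (update vis x 1) (update ql t q) (update al t a) rl
    queue-add w {x} {q} {a} refl refl refl r fresh row rewrite +-comm t 1 = record
      { ordered = m≤n⇒m≤1+n (ordered Q)
      ; counted = trans (sum<-update capacity (index<capacity w) fresh) (cong suc (counted Q))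
      ; binary  = binary′
      ; pending = pending′
      ; sound   = sound′
      ; handled = handled′
      ; found   = found Q
      }
      where
      vis′ = update vis x 1

      Stored′ = Stored (update ql t q) (update al t a) rl

      binary′ : ∀ i → vis′ i ≤ 1
      binary′ i with i ≟ index w
      ... | yes i≡x = ≤-reflexive (update-same vis x 1 i≡x)
      ... | no  i≢x = ≤-trans (≤-reflexive (update-other vis x 1 i≢x)) (binary Q i)

      inv : ∀ v → Visited vis′ v → v ≡ w ⊎ Visited vis v
      inv v vs with index v ≟ index w
      ... | yes eq = inj₁ (index-injective v w eq)
      ... | no  ne = inj₂ λ z → vs (trans (update-other vis x 1 ne) z)

      keep : ∀ {i} v → i < t → Stored ql al rl i v → Stored′ i v
      keep v i<t (q₁ , a₁ , r₁) = trans (update-other ql t q (<⇒≢ i<t)) q₁ ,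
        trans (update-other al t a (<⇒≢ i<t)) a₁ , r₁

      new : Stored′ t w
      new = update-same ql t q refl , update-same al t a refl , row

      pending′ : ∀ i → h ≤ i → i < suc t → ∃[ v ] Stored′ i v × Visited vis′ v
      pending′ i h≤i i<1+t with m<1+n⇒m<n∨m≡n i<1+t
      ... | inj₂ refl = w , new , visited-new vis w refl
      ... | inj₁ i<t with pending Q i h≤i i<t
      ...   | v , st , vs = v , keep v i<t st , visited-mono vis x v vs

      sound′ : ∀ v → Visited vis′ v → Reach v
      sound′ v vs with inv v vs
      ... | inj₁ refl = r
      ... | inj₂ vs′  = sound Q v vs′

      handled′ : ∀ v → Visited vis′ v →
        (∃[ i ] h ≤ i × i < suc t × Stored′ i v) ⊎ Closed vis′ f v ⊎ X v
      handled′ v vs with inv v vs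
      ... | inj₁ refl = inj₁ (t , ordered Q , ≤-refl , new)
      ... | inj₂ vs′ with handled Q v vs′
      ...   | inj₁ (i , h≤i , i<t , st) = inj₁ (i , h≤i , m<n⇒m<1+n i<t , keep v i<t st)
      ...   | inj₂ (inj₁ (succ , uns)) =
        inj₂ (inj₁ ((λ u e → visited-mono vis x u (succ u e)) , uns))
      ...   | inj₂ (inj₂ v∈X) = inj₂ (inj₂ v∈X)

    -- The dequeued node is neither queued nor closed, hence becomes the only exception. A position
    -- determines its node, so no other node is lost from the queue.
    queue-pop : ∀ v → (∀ w → ¬ X w) → h < t → Stored ql al rl h v →
                Queue (_≡ v) (suc h) t f vis ql al rl
    queue-pop v none h<t st = record
      { ordered = h<t
      ; counted = counted Q
      ; binary  = binary Q
      ; pending = λ i h<i → pending Q i (<⇒≤ h<i)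
      ; sound   = sound Q
      ; handled = handled′
      ; found   = found Q
      }
      where
      handled′ : ∀ w → Visited vis w →
        (∃[ i ] suc h ≤ i × i < t × Stored ql al rl i w) ⊎ Closed vis f w ⊎ w ≡ v
      handled′ w vs with handled Q w vs
      ... | inj₂ (inj₁ cl)  = inj₂ (inj₁ cl)
      ... | inj₂ (inj₂ w∈X) = contradiction w∈X (none w)
      ... | inj₁ (i , h≤i , i<t , st′) with m≤n⇒m<n∨m≡n h≤i
      ...   | inj₁ h<i  = inj₁ (i , h<i , i<t , st′)
      ...   | inj₂ refl = inj₂ (inj₂ (stored-unique {ql} {al} {rl} {h} w v st′ st))

    queue-close : ∀ {Y} → (∀ w → X w → Closed vis f w) → Queue Y h t f vis ql al rl
    queue-close close = record
      { ordered = ordered Q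
      ; counted = counted Q
      ; binary  = binary Q
      ; pending = pending Q
      ; sound   = sound Q
      ; handled = λ w vs → map₂ (λ { (inj₁ cl) → inj₁ cl ; (inj₂ w∈X) → inj₁ (close w w∈X) })
                             (handled Q w vs)
      ; found   = found Q
      }

    queue-found : UnsafeReach → Queue X h t 1 vis ql al rl
    queue-found u = record
      { ordered = ordered Q
      ; counted = counted Q
      ; binary  = binary Q
      ; pending = pending Q
      ; sound   = sound Q
      ; handled = λ v vs → map₂ (map₁ (λ (succ , _) → succ , λ _ ())) (handled Q v vs)
      ; found   = λ _ → u
      }

  Static : State → Set
  Static s = reg s rD ≡ 𝙳 × reg s rL ≡ 𝙻 × reg s rC ≡ 𝙲 ×
    arr s aδL ≡ table (transitions leader) × arr s aδC ≡ table (transitions contributor) ×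
    arr s aBad ≡ table (lookup unsafe)

  Queued : (Node → Set) → ℕ → State → Set
  Queued X h s =
    Queue X h (reg s rTail) (reg s rFound) (arr s aVisited) (arr s aLead) (arr s aMem) (arr s aRow)

  Vis : State → Node → Set
  Vis s = Visited (arr s aVisited)

  -- Initial states and the initial memory value witness that no parameter is zero, which the loop
  -- rule and all cost products rely on.
  1≤𝙲 : 1 ≤ 𝙲
  1≤𝙲 = ≤-trans (s≤s z≤n) (toℕ<n (q⁰ contributor))

  1≤𝙻 : 1 ≤ 𝙻
  1≤𝙻 = ≤-trans (s≤s z≤n) (toℕ<n (q⁰ leader))

  1≤𝙳 : 1 ≤ 𝙳
  1≤𝙳 = ≤-trans (s≤s z≤n) (toℕ<n a⁰)

  1≤𝙲³ : 1 ≤ 𝙲 * (𝙲 * 𝙲)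
  1≤𝙲³ = *-mono-≤ 1≤𝙲 (*-mono-≤ 1≤𝙲 1≤𝙲)

  1≤𝙻𝙲³ : 1 ≤ 𝙻 * (𝙲 * (𝙲 * 𝙲))
  1≤𝙻𝙲³ = *-mono-≤ 1≤𝙻 1≤𝙲³

  1≤capacity : 1 ≤ capacity
  1≤capacity = ≤-trans (s≤s z≤n) (index<capacity root)

  -- The work per node, of order `𝙳 * (𝙻 * 𝙲 + 𝙲 ^ 3)`, rounded up to a single product.
  unit : ℕ
  unit = 𝙳 * (𝙻 * (𝙲 * (𝙲 * 𝙲)))

  1≤unit : 1 ≤ unit
  1≤unit = *-mono-≤ 1≤𝙳 1≤𝙻𝙲³

  𝙲≤unit : 𝙲 ≤ unit
  𝙲≤unit = ≤-trans (≤-*ʳ (*-mono-≤ 1≤𝙲 1≤𝙲)) (≤-trans (≤-*ˡ 1≤𝙻) (≤-*ˡ 1≤𝙳))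

  -- Execution with all stored values at most `W`

  module Timed (W : ℕ) (capacity<W : capacity < W) (2^𝙲≤W : 2 ^ 𝙲 ≤ W) (𝙲≤W : 𝙲 ≤ W)
               (𝙻≤W : 𝙻 ≤ W) (codes≤W : 1 + 𝙳 + 𝙳 ≤ W) where
    open Hoare W

    𝙳≤W : 𝙳 ≤ W
    𝙳≤W = ≤-trans (m≤n+m 𝙳 (1 + 𝙳)) codes≤W

    1≤W : 1 ≤ W
    1≤W = ≤-trans 1≤𝙲 𝙲≤W

    below : ∀ {n x} (i : Fin n) → x ≡ toℕ i → n ≤ W → x ≤ W
    below i refl n≤W = ≤-trans (<⇒≤ (toℕ<n i)) n≤W

    horner≤W : ∀ v {i} → i ≤ 𝙲 → horner (bits v) i ≤ W
    horner≤W v {i} i≤C =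
      ≤-trans (<⇒≤ (horner<2^ i (bits≤1 v))) (≤-trans (^-monoʳ-≤ 2 i≤C) 2^𝙲≤W)

    -- The target enters only through the bits that `insert` yields, so one specification serves the
    -- root, the leader moves and the contributor moves.
    run-push : ∀ {X} h w s → Static s → Queued X h s → Reach w →
      reg s rLead′ ≡ toℕ (lead w) → reg s rMem′ ≡ toℕ (mem w) →
      (∀ j → j < 𝙲 → insert (reg s rNew) (arr s aSet j) j ≡ bits w j) →
      Run push s (𝙲 * 70) λ s′ → Static s′ × Queued X h s′ ×
        (∀ v → Vis s v → Vis s′ v) × Vis s′ w × arr s′ aSet ≡ arr s aSet
    run-push {X} h w s st@(_ , _ , C≡ , _) Q r q≡ a≡ row =
      -- 2 for clearing `rIndex`, 42 = 14 + 28 per bit, and 26 for completing the number, looking it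
      -- up and enqueuing.
      run-weaken (absorb 2 42 26 1≤𝙲 _) (λ _ _ x → x)
        (run-seq (run-assign z≤n
          (run-seq (run-weaken ≤-refl after
            (run-for P refl refl 1≤𝙲 𝙲≤W C≡ (st , Q , refl , refl , refl , λ _ ()) body)))))
      where
      s₀ = s ⟪ rIndex , 0 ⟫

      P : ℕ → State → Set
      P i s₁ = Static s₁ × Queued X h s₁ × arr s₁ aVisited ≡ arr s aVisited ×
        arr s₁ aSet ≡ arr s aSet × reg s₁ rIndex ≡ horner (bits w) i ×
        (∀ j → j < i → arr s₁ aRow (reg s₁ rTail * 𝙲 + j) ≡ bits w j)

      body : ∀ i s₁ → i < 𝙲 → reg s₁ rPos ≡ i → Frame (For rPos rC pushBit) s₀ s₁ → P i s₁ →
             Run pushBit s₁ 28 (λ s₂ → P (suc i) (s₂ ⟪ rPos , suc i ⟫))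
      body i s₁ i<C refl fr (st₁@(_ , _ , C≡₁ , _) , Q₁ , vis≡ , set≡ , idx≡ , row₁) =
        run-seq (run-assign (subst (_≤ W) (sym b≡) (≤-trans (bits≤1 w i) 1≤W))
          (run-seq (run-store (subst (_≤ W) (sym b≡) (≤-trans (bits≤1 w i) 1≤W))
            (run-assign (subst (_≤ W) (sym idx≡′) (horner≤W w i<C))
              (st₁ , queue-write Q₁ at i<C , vis≡ , set≡ , idx≡′ , row₂)))))
        where
        b = insert (reg s₁ rNew) (arr s₁ aSet i) i

        b≡ : b ≡ bits w i
        b≡ = trans (cong₂ (λ p f → insert p (f i) i) (fr rNew refl) set≡) (row i i<C)

        idx≡′ : reg s₁ rIndex + reg s₁ rIndex + b ≡ horner (bits w) (suc i)
        idx≡′ = cong₂ _+_ (cong₂ _+_ idx≡ idx≡) b≡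

        at : reg s₁ rTail * reg s₁ rC + i ≡ reg s₁ rTail * 𝙲 + i
        at = cong (λ c → reg s₁ rTail * c + i) C≡₁

        row₂ : ∀ j → j < suc i →
          update (arr s₁ aRow) (reg s₁ rTail * reg s₁ rC + i) b (reg s₁ rTail * 𝙲 + j) ≡ bits w j
        row₂ j j<1+i with m<1+n⇒m<n∨m≡n j<1+i
        ... | inj₂ refl = trans (update-same (arr s₁ aRow) _ b (sym at)) b≡
        ... | inj₁ j<i  = trans (update-other (arr s₁ aRow) _ b λ eq →
          <⇒≢ j<i (+-cancelˡ-≡ (reg s₁ rTail * 𝙲) j i (trans eq at))) (row₁ j j<i)

      Post : State → Set
      Post s′ = Static s′ × Queued X h s′ × (∀ v → Vis s v → Vis s′ v) × Vis s′ w × arr s′ aSet ≡ arr s aSet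

      after : ∀ s₁ → Frame (For rPos rC pushBit) s₀ s₁ → P 𝙲 s₁ →
        Run (rIndex ≔ (var rIndex ⊗ var rL ⊕ var rLead′) ⊗ var rD ⊕ var rMem′ ⨾
             branch (aVisited ! var rIndex) skip enqueue) s₁ 26 Post
      after s₁ fr (st₁@(D≡ , L≡ , C≡₁ , _) , Q₁ , vis≡ , set≡ , idx≡ , row₁) =
        run-seq (run-assign (subst (_≤ W) (sym x≡) (<⇒≤ (<-trans (index<capacity w) capacity<W)))
          (run-branch
            (λ old → run-weaken (s≤s z≤n) (λ _ _ q → q) (run-skip
              (st₁ , Q₁ , mono₁ , subst (λ y → arr s₁ aVisited y ≢ 0) x≡ old , set≡)))
            (λ new →
              run-seq (run-store 1≤W
                (run-seq (run-store (below (lead w) q≡₁ 𝙻≤W)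
                  (run-seq (run-store (below (mem w) a≡₁ 𝙳≤W)
                    (run-assign tail≤W
                      (st₁ , queue-add Q₁ w x≡ q≡₁ a≡₁ r new row₁ ,
                       (λ v vs → visited-mono (arr s₁ aVisited) x v (mono₁ v vs)) ,
                       visited-new (arr s₁ aVisited) w x≡ , set≡))))))))))
        where
        x = (reg s₁ rIndex * reg s₁ rL + reg s₁ rLead′) * reg s₁ rD + reg s₁ rMem′

        q≡₁ : reg s₁ rLead′ ≡ toℕ (lead w)
        q≡₁ = trans (fr rLead′ refl) q≡

        a≡₁ : reg s₁ rMem′ ≡ toℕ (mem w)
        a≡₁ = trans (fr rMem′ refl) a≡

        x≡ : x ≡ index w
        x≡ = cong₂ _+_ (cong₂ _*_ (cong₂ _+_ (cong₂ _*_ idx≡ L≡) q≡₁) D≡) a≡₁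

        mono₁ : ∀ v → Vis s v → Vis s₁ v
        mono₁ v = subst (λ f → Visited f v) (sym vis≡)

        -- The old tail is only known to be at most `capacity`, so the increment uses that
        -- `capacity < W` is strict.
        tail≤W : reg s₁ rTail + 1 ≤ W
        tail≤W = ≤-trans (≤-reflexive (+-comm (reg s₁ rTail) 1))
          (≤-trans (s≤s (bounded Q₁)) capacity<W)

    module Processing (h : ℕ) (v : Node) (r : Reach v) where

      Inv : State → Set
      Inv s = Static s × Queued (_≡ v) h s × reg s rHead ≡ h × reg s rLead ≡ toℕ (lead v) ×
        reg s rMem ≡ toℕ (mem v) × (∀ j → j < 𝙲 → arr s aSet j ≡ bits v j)

      -- `G` collects the nodes that the command promises to mark. As marks never disappear,
      -- sequencing and loops simply take unions of these promises.
      Visits : Cmd → State → ℕ → (Node → Set) → Set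
      Visits c s n G = Run c s n λ s′ →
        Inv s′ × (∀ w → Vis s w → Vis s′ w) × (∀ w → G w → Vis s′ w)

      visits-weaken : ∀ {c s m n G H} → m ≤ n → (∀ w → H w → G w) → Visits c s m G → Visits c s n H
      visits-weaken m≤n H⊆G =
        run-weaken m≤n λ _ _ (j , mono , goal) → j , mono , λ w w∈H → goal w (H⊆G w w∈H)

      visits-seq : ∀ {c d s m n G H} → Visits c s m G →
        (∀ s′ → Frame c s s′ → Inv s′ → Visits d s′ n H) →
        Visits (c ⨾ d) s (m + n) (λ w → G w ⊎ H w)
      visits-seq p q = run-seq (run-weaken ≤-refl
        (λ s′ fr (j , mono , goal) → run-weaken ≤-refl
          (λ s″ _ (j′ , mono′ , goal′) → j′ , (λ w x → mono′ w (mono w x)) ,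
            λ { w (inj₁ x) → mono′ w (goal w x) ; w (inj₂ x) → goal′ w x })
          (q s′ fr j)) p)

      visits-assign : ∀ {x e c s n G} → ⟦ e ⟧ s ≤ W → Visits c (s ⟪ x , ⟦ e ⟧ s ⟫) n G →
        Visits (x ≔ e ⨾ c) s (1 + cost e + n) G
      visits-assign b p = run-seq (run-assign b p)

      visits-if : ∀ {e c s n G} b → ⟦ e ⟧ s ≡ bit b → 1 ≤ n → Inv s →
        (b ≡ true → Visits c s n G) →
        Visits (branch e c skip) s (1 + cost e + n) (λ w → b ≡ true × G w)
      visits-if b eq 1≤n j p = run-branch
        (λ ne → visits-weaken ≤-refl (λ _ → proj₂) (p (bit≢0 λ z → ne (trans eq z))))
        (λ z → run-weaken 1≤n (λ _ _ q → q) (run-skip (j , (λ _ x → x) ,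
          λ { w (refl , _) → contradiction (trans (sym z) eq) λ () })))

      -- The premise on updates says that the counter is not among the registers of `Inv`; for a
      -- concrete counter it holds by computation.
      visits-for : ∀ {x y c n k s} {G : Fin n → Node → Set} →
        (∀ s i → Inv s → Inv (s ⟪ x , i ⟫)) →
        modifies (For x y c) y ≡ false → modifies c x ≡ false →
        1 ≤ n → n ≤ W → reg s y ≡ n → Inv s →
        (∀ i s₁ → reg s₁ x ≡ toℕ i → Frame (For x y c) s s₁ → Inv s₁ → Visits c s₁ k (G i)) →
        Visits (For x y c) s (n * (14 + k)) (λ w → ∃[ i ] G i w)
      visits-for {x} {y} {c} {n} {k} {s} {G} stable y-kept x-kept 1≤n n≤W y≡n j body =
        run-weaken ≤-refl
          (λ s′ _ (j′ , mono , goal) → j′ , mono , λ w (i , g) → goal i (toℕ<n i) w g)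
          (run-for P y-kept x-kept 1≤n n≤W y≡n (stable s 0 j , (λ _ x → x) , λ _ ()) iteration)
        where
        P : ℕ → State → Set
        P m s₁ = Inv s₁ × (∀ w → Vis s w → Vis s₁ w) × (∀ i → toℕ i < m → ∀ w → G i w → Vis s₁ w)

        iteration : ∀ m s₁ → m < n → reg s₁ x ≡ m → Frame (For x y c) s s₁ → P m s₁ →
                    Run c s₁ k (λ s₂ → P (suc m) (s₂ ⟪ x , suc m ⟫))
        iteration m s₁ m<n x≡m fr (j₁ , mono , goal) =
          run-weaken ≤-refl
            (λ s₂ _ (j₂ , mono₂ , goal₂) → stable s₂ (suc m) j₂ , (λ w z → mono₂ w (mono w z)) ,
              all s₂ mono₂ goal₂)
            (body (fromℕ< m<n) s₁ (trans x≡m (sym (toℕ-fromℕ< m<n))) fr j₁)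
          where
          all : ∀ s₂ → (∀ w → Vis s₁ w → Vis s₂ w) → (∀ w → G (fromℕ< m<n) w → Vis s₂ w) →
                ∀ i → toℕ i < suc m → ∀ w → G i w → Vis s₂ w
          all s₂ mono₂ goal₂ i i<1+m w g with m<1+n⇒m<n∨m≡n i<1+m
          ... | inj₁ i<m = mono₂ w (goal i i<m w g)
          ... | inj₂ i≡m = goal₂ w (subst (λ i → G i w)
            (toℕ-injective (trans i≡m (sym (toℕ-fromℕ< m<n)))) g)

      visits-push : ∀ w s → Inv s → Reach w →
        reg s rLead′ ≡ toℕ (lead w) → reg s rMem′ ≡ toℕ (mem w) →
        (∀ j → j < 𝙲 → insert (reg s rNew) (arr s aSet j) j ≡ bits w j) →
        Visits push s (𝙲 * 70) (λ u → u ≡ w)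
      visits-push w s (st , Q , head≡ , q≡ , a≡ , set≡) rw q′≡ a′≡ row =
        run-weaken ≤-refl
          (λ s′ fr (st′ , Q′ , mono , new , same) →
            (st′ , Q′ , trans (fr rHead refl) head≡ , trans (fr rLead refl) q≡ ,
             trans (fr rMem refl) a≡ , (λ j j<C → trans (cong (λ f → f j) same) (set≡ j j<C))) ,
            mono , λ { u refl → new })
          (run-push h w s st Q rw q′≡ a′≡ row)

      ByLeader ByContributor : Maybe (Op (Fin 𝙳)) → Fin 𝙳 → Node → Set
      ByLeader o a′ w = ∃[ q′ ] δ leader (lead v) o q′ ≡ true × w ≡ node q′ a′ (set v)
      ByContributor o a′ w = ∃[ p ] lookup (set v) p ≡ true ×
        (∃[ p′ ] δ contributor p o p′ ≡ true × w ≡ node (lead v) a′ (set v ∪｛ p′ ｝))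

      transition≡ : ∀ (P : NFA (Op (Fin 𝙳))) {f k m q q′} o (i j : Fin (size P)) → f ≡ table (transitions P) →
        k ≡ code o → m ≡ size P → q ≡ toℕ i → q′ ≡ toℕ j →
        f ((k * m + q) * m + q′) ≡ bit (δ P i o j)
      transition≡ P o i j refl refl refl refl refl = transitions-at P i o j

      visits-leader : ∀ o a′ → Eff o (mem v) a′ → ∀ s → Inv s →
        reg s rCode ≡ code o → reg s rMem′ ≡ toℕ a′ →
        Visits leaderMoves s (𝙻 * 𝙲 * 97) (ByLeader o a′)
      visits-leader o a′ e s j@((_ , L≡ , C≡ , _) , _) o≡ a′≡ =
        -- 2 for setting `rNew`, 25 = 14 + 11 for a loop round with its table lookup, and 70 per bit
        -- for the push.
        visits-weaken (absorb₂ 2 25 70 1≤𝙻 1≤𝙲 _) (λ _ x → x)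
          (visits-assign (≤-trans (≤-reflexive C≡) 𝙲≤W)
            (visits-for (λ _ _ j → j) refl refl 1≤𝙻 𝙻≤W L≡ j body))
        where
        body : ∀ q′ s₁ → reg s₁ rLead′ ≡ toℕ q′ → Frame (For rLead′ rL tryLeader) (s ⟪ rNew , reg s rC ⟫) s₁ → Inv s₁ →
          Visits tryLeader s₁ (11 + 𝙲 * 70) (λ w → δ leader (lead v) o q′ ≡ true × w ≡ node q′ a′ (set v))
        body q′ s₁ q′≡ fr j₁@((_ , L≡₁ , _ , δL≡ , _) , _ , _ , q≡ , _ , set≡) =
          visits-if (δ leader (lead v) o q′)
            (transition≡ leader o (lead v) q′ δL≡ (trans (fr rCode refl) o≡) L≡₁ q≡ q′≡)
            (*-mono-≤ 1≤𝙲 (s≤s z≤n)) j₁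
            λ d → visits-push (node q′ a′ (set v)) s₁ j₁ (then r (leads d e)) q′≡
              (trans (fr rMem′ refl) a′≡)
              λ i i<C → trans
                (insert-other
                  (λ i≡ → <⇒≢ i<C (trans i≡ (trans (fr rNew refl) C≡)))
                  (≤-trans (≤-reflexive (set≡ i i<C)) (bits≤1 v i)))
                (set≡ i i<C)

      visits-contributor : ∀ o a′ → Eff o (mem v) a′ → ∀ s → Inv s →
        reg s rCode ≡ code o → reg s rMem′ ≡ toℕ a′ →
        Visits contributorMoves s (𝙲 * (𝙲 * 𝙲) * 114) (ByContributor o a′)
      visits-contributor o a′ e s j@((_ , _ , C≡ , _) , _ , _ , q≡ , _) o≡ a′≡ =
        visits-weaken (absorb₂ 2 17 95 1≤𝙲 1≤𝙲² _) (λ _ x → x)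
          (visits-assign (below (lead v) q≡ 𝙻≤W)
            (visits-for (λ _ _ j → j) refl refl 1≤𝙲 𝙲≤W C≡ j outer))
        where
        1≤𝙲² : 1 ≤ 𝙲 * 𝙲
        1≤𝙲² = *-mono-≤ 1≤𝙲 1≤𝙲

        outer : ∀ p s₁ → reg s₁ rOld ≡ toℕ p → Frame (For rOld rC tryContributors) (s ⟪ rLead′ , reg s rLead ⟫) s₁ → Inv s₁ →
          Visits tryContributors s₁ (3 + 𝙲 * 𝙲 * 95) (λ w → lookup (set v) p ≡ true ×
            (∃[ p′ ] δ contributor p o p′ ≡ true × w ≡ node (lead v) a′ (set v ∪｛ p′ ｝)))
        outer p s₁ p≡ fr j₁@((_ , _ , C≡₁ , _) , _ , _ , _ , _ , set≡) =
          visits-if (lookup (set v) p)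
            (trans (cong (arr s₁ aSet) p≡)
              (trans (set≡ (toℕ p) (toℕ<n p)) (table-toℕ (lookup (set v)) p)))
            (*-mono-≤ 1≤𝙲² (s≤s z≤n)) j₁
            λ p∈ → visits-weaken (absorb₂ 0 25 70 1≤𝙲 1≤𝙲 _) (λ _ x → x)
              (visits-for (λ _ _ j → j) refl refl 1≤𝙲 𝙲≤W C≡₁ j₁ (inner p∈))
          where
          inner : lookup (set v) p ≡ true → ∀ p′ s₂ → reg s₂ rNew ≡ toℕ p′ → Frame (For rNew rC tryContributor) s₁ s₂ → Inv s₂ →
            Visits tryContributor s₂ (11 + 𝙲 * 70) (λ w → δ contributor p o p′ ≡ true ×
              w ≡ node (lead v) a′ (set v ∪｛ p′ ｝))
          inner p∈ p′ s₂ p′≡ fr₂ j₂@((_ , _ , C≡₂ , _ , δC≡ , _) , _ , _ , _ , _ , set≡₂) =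
            visits-if (δ contributor p o p′)
              (transition≡ contributor o p p′ δC≡
                (trans (fr₂ rCode refl) (trans (fr rCode refl) o≡)) C≡₂
                (trans (fr₂ rOld refl) p≡) p′≡)
              (*-mono-≤ 1≤𝙲 (s≤s z≤n)) j₂
              λ d → visits-push (node (lead v) a′ (set v ∪｛ p′ ｝)) s₂ j₂
                (then r (contributes p∈ d e))
                (trans (fr₂ rLead′ refl) (trans (fr rLead′ refl) q≡))
                (trans (fr₂ rMem′ refl) (trans (fr rMem′ refl) a′≡))
                λ i i<C → trans (cong₂ (λ x b → insert x b i) p′≡ (set≡₂ i i<C))
                  (insert-table (set v) p′ i i<C)

      -- That no label is missed is inversion of `Eff`: from `mem v` there is ε, the read of this
      -- very value, or a write.
      visits-effects : ∀ {c X κ} {G : Maybe (Op (Fin 𝙳)) → Fin 𝙳 → Node → Set} →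
        modifies c rMem′ ≡ false → modifies c rD ≡ false → 1 ≤ X →
        (∀ o a′ → Eff o (mem v) a′ → ∀ s → Inv s → reg s rCode ≡ code o → reg s rMem′ ≡ toℕ a′ →
          Visits c s (X * κ) (G o a′)) →
        ∀ s → Inv s →
        Visits (forEffects c) s (𝙳 * X * (30 + 3 * κ))
          (λ w → ∃[ o ] ∃[ a′ ] Eff o (mem v) a′ × G o a′ w)
      visits-effects {c} {X} {κ} {G} mem-kept dom-kept 1≤X visits s j =
        visits-weaken (effects-cost κ 1≤𝙳 1≤X) cases
          (visits-assign z≤n (visits-assign (mem≤W s j)
            (visits-seq (visits nothing (mem v) ε _ j refl (mem≡ s j)) λ s₁ _ j₁ →
              visits-assign (code≤W s₁ j₁) (visits-assign (mem≤W s₁ j₁)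
                (visits-seq (visits (just (rd (mem v))) (mem v) read _ j₁ (code≡ s₁ j₁) (mem≡ s₁ j₁))
                  λ s₂ _ j₂ → visits-for (λ _ _ j → j) for-kept mem-kept′ 1≤𝙳 𝙳≤W
                    (proj₁ (proj₁ j₂)) j₂
                    λ b s₃ b≡ _ j₃ → visits-assign
                      (≤-trans (s≤s (≤-trans (≤-reflexive b≡) (<⇒≤ (toℕ<n b)))) (≤-trans (m≤m+n (1 + 𝙳) 𝙳) codes≤W))
                      (visits (just (wr b)) b write _ j₃ (cong suc b≡) b≡))))))
        where
        mem≡ : ∀ s → Inv s → reg s rMem ≡ toℕ (mem v)
        mem≡ s (_ , _ , _ , _ , a≡ , _) = a≡

        mem≤W : ∀ s → Inv s → reg s rMem ≤ W
        mem≤W s j = below (mem v) (mem≡ s j) 𝙳≤W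

        code≡ : ∀ s → Inv s → 1 + reg s rD + reg s rMem ≡ 1 + 𝙳 + toℕ (mem v)
        code≡ s j = cong₂ (λ d a → 1 + d + a) (proj₁ (proj₁ j)) (mem≡ s j)

        code≤W : ∀ s → Inv s → 1 + reg s rD + reg s rMem ≤ W
        code≤W s j = ≤-trans (≤-reflexive (code≡ s j))
          (≤-trans (+-monoʳ-≤ (1 + 𝙳) (<⇒≤ (toℕ<n (mem v)))) codes≤W)

        for-kept : modifies (For rMem′ rD (rCode ≔ con 1 ⊕ var rMem′ ⨾ c)) rD ≡ false
        for-kept rewrite dom-kept = refl

        mem-kept′ : modifies (rCode ≔ con 1 ⊕ var rMem′ ⨾ c) rMem′ ≡ false
        mem-kept′ = mem-kept

        cases : ∀ w → (∃[ o ] ∃[ a′ ] Eff o (mem v) a′ × G o a′ w) →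
          G nothing (mem v) w ⊎ G (just (rd (mem v))) (mem v) w ⊎ (∃[ b ] G (just (wr b)) b w)
        cases w (_ , _ , ε     , g) = inj₁ g
        cases w (_ , _ , read  , g) = inj₂ (inj₁ g)
        cases w (_ , b , write , g) = inj₂ (inj₂ (b , g))

    -- The main loop and its result

    Unexplored : ℕ → State → Set
    Unexplored = Queued (λ _ → Empty)

    run-load : ∀ h v s → Static s → Unexplored h s → reg s rHead ≡ h →
      Stored (arr s aLead) (arr s aMem) (arr s aRow) h v →
      Run load s (3 + (3 + 𝙲 * 22)) λ s′ → Static s′ × Unexplored h s′ ×
        arr s′ aVisited ≡ arr s aVisited × reg s′ rHead ≡ h × reg s′ rLead ≡ toℕ (lead v) ×
        reg s′ rMem ≡ toℕ (mem v) × (∀ j → j < 𝙲 → arr s′ aSet j ≡ bits v j) ×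
        Stored (arr s′ aLead) (arr s′ aMem) (arr s′ aRow) h v
    run-load h v s st@(_ , _ , C≡ , _) Q refl stored@(q≡ , a≡ , row) =
      run-seq (run-assign (below (lead v) q≡ 𝙻≤W) (run-seq (run-assign (below (mem v) a≡ 𝙳≤W)
        (run-weaken ≤-refl
          (λ s′ fr (st′ , Q′ , vis≡ , stored′ , set≡) →
            st′ , Q′ , vis≡ , fr rHead refl , trans (fr rLead refl) q≡ ,
            trans (fr rMem refl) a≡ , set≡ , stored′)
          (run-for P refl refl 1≤𝙲 𝙲≤W C≡ (st , Q , refl , stored , λ _ ()) body)))))
      where
      copy = aSet [ var rPos ]≔ aRow ! (var rHead ⊗ var rC ⊕ var rPos)
      s₀ = s ⟪ rLead , arr s aLead h ⟫ ⟪ rMem , arr s aMem h ⟫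

      P : ℕ → State → Set
      P i s₁ = Static s₁ × Unexplored h s₁ × arr s₁ aVisited ≡ arr s aVisited ×
        Stored (arr s₁ aLead) (arr s₁ aMem) (arr s₁ aRow) h v ×
        (∀ j → j < i → arr s₁ aSet j ≡ bits v j)

      body : ∀ i s₁ → i < 𝙲 → reg s₁ rPos ≡ i → Frame (For rPos rC copy) s₀ s₁ → P i s₁ →
             Run copy s₁ 8 (λ s₂ → P (suc i) (s₂ ⟪ rPos , suc i ⟫))
      body i s₁ i<C refl fr (st₁@(_ , _ , C≡₁ , _) , Q₁ , vis≡ , stored₁@(_ , _ , row₁) , set≡) =
        run-store (subst (_≤ W) (sym b≡) (≤-trans (bits≤1 v i) 1≤W))
          (st₁ , Q₁ , vis≡ , stored₁ , set≡′)
        where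
        b = arr s₁ aRow (reg s₁ rHead * reg s₁ rC + i)

        b≡ : b ≡ bits v i
        b≡ = trans (cong₂ (λ x c → arr s₁ aRow (x * c + i)) (fr rHead refl) C≡₁) (row₁ i i<C)

        set≡′ : ∀ j → j < suc i → update (arr s₁ aSet) i b j ≡ bits v j
        set≡′ j j<1+i with m<1+n⇒m<n∨m≡n j<1+i
        ... | inj₂ refl = trans (update-same (arr s₁ aSet) i b refl) b≡
        ... | inj₁ j<i  = trans (update-other (arr s₁ aSet) i b (<⇒≢ j<i)) (set≡ j j<i)

    Loop : ℕ → State → Set
    Loop h s = Static s × Unexplored h s × reg s rHead ≡ h × Vis s root

    -- Termination: every iteration advances the head, which is below the tail and hence below
    -- `capacity`.
    run-process : ∀ h s → Loop h s → reg s rTail ∸ reg s rHead ≢ 0 →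
      h < capacity × Run process s (unit * 730) (Loop (suc h))
    run-process h s (st , Q , refl , vis-root) ne with pending Q h ≤-refl (m∸n≢0⇒n<m ne)
    ... | v , stored , vis-v = <-≤-trans h<t (bounded Q) ,
      run-weaken (process-cost 1≤𝙳 1≤𝙻 1≤𝙲) (λ _ _ q → q)
        (run-seq (run-weaken ≤-refl loaded (run-load h v s st Q refl stored)))
      where
      h<t : h < reg s rTail
      h<t = m∸n≢0⇒n<m ne

      open Processing (suc h) v (sound Q v vis-v)

      moves = forEffects leaderMoves ⨾ forEffects contributorMoves

      goals : ∀ {s₃} → (∀ w → (∃[ o ] ∃[ a′ ] Eff o (mem v) a′ × ByLeader o a′ w) ⊎
                 (∃[ o ] ∃[ a′ ] Eff o (mem v) a′ × ByContributor o a′ w) → Vis s₃ w) →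
              ∀ w → v ⟶ w → Vis s₃ w
      goals goal w (leads d e)          = goal w (inj₁ (_ , _ , e , _ , d , refl))
      goals goal w (contributes p∈ d e) = goal w (inj₂ (_ , _ , e , _ , p∈ , _ , d , refl))

      explore : ∀ s₂ → Inv s₂ → Vis s₂ root → (lookup unsafe (lead v) ≡ true → reg s₂ rFound ≢ 0) →
        Run moves s₂ (𝙳 * (𝙻 * 𝙲) * 321 + 𝙳 * (𝙲 * (𝙲 * 𝙲)) * 372) (Loop (suc h))
      explore s₂ j vis-root₂ uns = run-weaken ≤-refl
        (λ s₃ fr ((st₃ , Q₃ , head≡ , _) , mono , goal) →
          st₃ , queue-close Q₃ (λ { w refl → goals {s₃} goal ,
            λ u → subst (_≢ 0) (sym (fr rFound refl)) (uns u) }) ,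
          head≡ , mono root vis-root₂)
        (visits-seq (visits-effects refl refl (*-mono-≤ 1≤𝙻 1≤𝙲) visits-leader s₂ j)
          λ s₃ _ j₃ → visits-effects refl refl (*-mono-≤ 1≤𝙲 (*-mono-≤ 1≤𝙲 1≤𝙲))
            visits-contributor s₃ j₃)

      loaded : ∀ s₁ → Frame load s s₁ → (Static s₁ × Unexplored h s₁ ×
          arr s₁ aVisited ≡ arr s aVisited × reg s₁ rHead ≡ h × reg s₁ rLead ≡ toℕ (lead v) ×
          reg s₁ rMem ≡ toℕ (mem v) × (∀ j → j < 𝙲 → arr s₁ aSet j ≡ bits v j) ×
          Stored (arr s₁ aLead) (arr s₁ aMem) (arr s₁ aRow) h v) →
        Run (rHead ≔ var rHead ⊕ con 1 ⨾
             branch (aBad ! var rLead) (rFound ≔ con 1) skip ⨾ moves) s₁ _ (Loop (suc h))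
      loaded s₁ fr (st₁@(_ , _ , _ , _ , _ , uns≡) , Q₁ , vis≡ , head≡ , q≡ , a≡ , set≡ , stored₁) =
        run-seq (run-assign
          (≤-trans (≤-reflexive head≡′) (≤-trans h<t (≤-trans (bounded Q) (<⇒≤ capacity<W))))
          (run-seq (run-branch
            (λ yes → run-assign 1≤W (explore _
              (st₁ , queue-found Q₂ (v , sound Q v vis-v , bit≢0 λ z → yes (trans guard z)) ,
               head≡′ , q≡ , a≡ , set≡) vis-root₁ (λ _ ())))
            (λ no → run-weaken (s≤s z≤n) (λ _ _ q → q) (run-skip (explore _
              (st₁ , Q₂ , head≡′ , q≡ , a≡ , set≡) vis-root₁
              (λ u _ → contradiction (trans (sym no) (trans guard (cong bit u))) λ ())))))))
        where
        head≡′ : reg s₁ rHead + 1 ≡ suc h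
        head≡′ = trans (+-comm _ 1) (cong suc head≡)

        Q₂ = queue-pop Q₁ v (λ _ ()) (subst (h <_) (sym (fr rTail refl)) h<t) stored₁

        guard : arr s₁ aBad (reg s₁ rLead) ≡ bit (lookup unsafe (lead v))
        guard = trans (cong₂ (λ f x → f x) uns≡ q≡) (table-toℕ (lookup unsafe) (lead v))

        vis-root₁ : Vis s₁ root
        vis-root₁ = subst (λ f → Visited f root) (sym vis≡) vis-root

    run-search : Run search (encode I) (capacity * unit * 818) λ s → reg s 0 ≢ 0 ⇔ UnsafeReach
    run-search =
      run-weaken (search-cost 1≤capacity 1≤unit 𝙲≤unit) (λ _ _ q → q)
        (run-seq (run-assign (below (q⁰ leader) refl 𝙻≤W)
          (run-seq (run-assign (below a⁰ refl 𝙳≤W)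
            (run-seq (run-assign (below (q⁰ contributor) refl 𝙲≤W)
              (run-seq (run-weaken ≤-refl pushed
                (run-push 0 root _ (refl , refl , refl , refl , refl , refl) empty here refl refl row)))))))))
      where
      empty : Queue (λ _ → Empty) 0 0 0 (λ _ → 0) (λ _ → 0) (λ _ → 0) (λ _ → 0)
      empty = record
        { ordered = z≤n
        ; counted = sum<-zero capacity
        ; binary  = λ _ → z≤n
        ; pending = λ _ _ ()
        ; sound   = λ _ vs → contradiction refl vs
        ; handled = λ _ vs → contradiction refl vs
        ; found   = λ ne → contradiction refl ne
        }

      row : ∀ j → j < 𝙲 → insert (toℕ (q⁰ contributor)) 0 j ≡ bits root j
      row j j<C = trans (cong (λ b → insert (toℕ (q⁰ contributor)) b j) (sym (table-⊥ {𝙲} j)))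
        (insert-table ⊥ (q⁰ contributor) j j<C)

      s₀ = encode I ⟪ rLead′ , toℕ (q⁰ leader) ⟫ ⟪ rMem′ , toℕ a⁰ ⟫ ⟪ rNew , toℕ (q⁰ contributor) ⟫

      main = while (var rTail ⊖ var rHead) process ⨾ branch (var rFound) (0 ≔ con 1) (0 ≔ con 0)

      Answer : State → Set
      Answer s = reg s 0 ≢ 0 ⇔ UnsafeReach

      -- On exit the head has met the tail, so every visited node is closed. The visited nodes
      -- contain `root`, hence everything reachable, and a reachable unsafe node would have raised
      -- the flag.
      finish : ∀ s → reg s rTail ∸ reg s rHead ≡ 0 × (∃[ h ] Loop h s) →
               Run (branch (var rFound) (0 ≔ con 1) (0 ≔ con 0)) s 4 Answer
      finish s (z , h , st , Q , refl , vis-root) = run-branch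
        (λ yes → run-assign 1≤W (mk⇔ (λ _ → found Q yes) (λ _ ())))
        (λ no → run-assign z≤n (mk⇔ (λ ne → contradiction refl ne)
          (λ (v , r , u) → contradiction no (proj₂ (closed v (all r)) u))))
        where
        closed : ∀ v → Vis s v → Closed (arr s aVisited) (reg s rFound) v
        closed v vs with handled Q v vs
        ... | inj₁ (i , h≤i , i<t , _) =
          contradiction (<-≤-trans i<t (m∸n≡0⇒m≤n z)) (≤⇒≯ h≤i)
        ... | inj₂ (inj₁ cl) = cl

        all : ∀ {v} → Reach v → Vis s v
        all here           = vis-root
        all (then {v} r e) = proj₁ (closed v (all r)) _ e

      pushed : ∀ s₁ → Frame push s₀ s₁ →
               (Static s₁ × Unexplored 0 s₁ × (∀ v → Vis s₀ v → Vis s₁ v) × Vis s₁ root × arr s₁ aSet ≡ arr s₀ aSet) →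
               Run main s₁ (4 + capacity * (4 + unit * 730) + 4) Answer
      pushed s₁ fr (st , Q , _ , vis-root , _) = run-seq (run-weaken ≤-refl (λ s _ → finish s)
        (run-while Loop run-process capacity 0 s₁ refl (st , Q , fr rHead refl , vis-root)))

  -- Total time and transfer to `LCR`

  time : ℕ
  time = 2 ^ 𝙲 * 𝙲 ^ 4 * 𝙻 ^ 2 * 𝙳 ^ 2

  unit≤time : capacity * unit ≤ time
  -- The product carries `𝙲 ^ 3`; one more factor `𝙲` rounds it up to the claimed bound.
  unit≤time = ≤-trans (≤-*ʳ 1≤𝙲) (≤-reflexive (regroup (2 ^ 𝙲) 𝙲 𝙻 𝙳))
    where
    regroup : ∀ p c l d → p * l * d * (d * (l * (c * (c * c)))) * c ≡
      p * (c * (c * (c * (c * 1)))) * (l * (l * 1)) * (d * (d * 1))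
    regroup = solve-∀

  capacity≤time : capacity ≤ time
  capacity≤time = ≤-trans (≤-*ʳ 1≤unit) unit≤time

  ≤unit⇒≤time : ∀ {n} → n ≤ unit → n ≤ time
  ≤unit⇒≤time n≤unit = ≤-trans n≤unit (≤-trans (≤-*ˡ 1≤capacity) unit≤time)

  2^𝙲≤time : 2 ^ 𝙲 ≤ time
  2^𝙲≤time = ≤-trans (≤-trans (≤-*ʳ 1≤𝙻) (≤-*ʳ 1≤𝙳)) capacity≤time

  𝙻≤unit : 𝙻 ≤ unit
  𝙻≤unit = ≤-trans (≤-*ʳ 1≤𝙲³) (≤-*ˡ 1≤𝙳)

  unsafe⇔LCR : UnsafeReach ⇔ LCR I
  unsafe⇔LCR = mk⇔ to from
    where
    to : UnsafeReach → LCR I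
    to (v , r , u) with realise r
    ... | t , pc , path , refl , _ = t , (pc , mem v) , path , lookup⇒[]= (pc zero) unsafe u

    from : LCR I → UnsafeReach
    from (t , (pc , a) , path , bad)
      with abstract-path root (refl , refl , λ _ → added ⊥ (q⁰ contributor)) here path
    ... | v , (refl , _ , _) , r = v , r , []=⇒lookup bad

  -- The same `K` scales the time and the word bound. Keeping it a variable prevents `K * time` from
  -- unfolding into a long sum.
  search-solves : ∀ K → 818 ≤ K → ∃[ s ] ∃[ n ]
    (K * time ⊢ search , encode I ⇓ s ⟨ n ⟩) × n ≤ K * time × (reg s 0 ≢ 0 ⇔ LCR I)
  search-solves K 818≤K =
    let s , n , run , n≤ , answer = Timed.run-search (K * time) capacity<words (words 2^𝙲≤time)
          (words (≤unit⇒≤time 𝙲≤unit)) (words (≤unit⇒≤time 𝙻≤unit)) codes≤words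
    in s , n , run , ≤-trans n≤ n-bound , unsafe⇔LCR ⇔-∘ answer
    where
    n-bound : capacity * unit * 818 ≤ K * time
    n-bound = subst (_≤ K * time) (*-comm 818 (capacity * unit)) (*-mono-≤ 818≤K unit≤time)

    words : ∀ {n} → n ≤ time → n ≤ K * time
    words n≤time = ≤-trans n≤time (≤-*ˡ (≤-trans (≤ᵇ⇒≤ 1 818 _) 818≤K))

    capacity<words : capacity < K * time
    capacity<words = ≤-trans (+-mono-≤ 1≤capacity (≤-reflexive (sym (+-identityʳ capacity))))
      (*-mono-≤ (≤-trans (≤ᵇ⇒≤ 2 818 _) 818≤K) capacity≤time)

    codes≤words : 1 + 𝙳 + 𝙳 ≤ K * time
    codes≤words = ≤-trans (+-mono-≤ (+-monoˡ-≤ 𝙳 1≤𝙳) ≤-refl) (≤-trans (≤-reflexive (triple 𝙳))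
      (*-mono-≤ (≤-trans (≤ᵇ⇒≤ 3 818 _) 818≤K) (≤unit⇒≤time {𝙳} (≤-*ʳ 1≤𝙻𝙲³))))
      where
      triple : ∀ d → d + d + d ≡ 3 * d
      triple = solve-∀

theorem11 : SolvableInTime encode LCR (λ I → let open Instance I in 2 ^ 𝙲 * 𝙲 ^ 4 * 𝙻 ^ 2 * 𝙳 ^ 2)
theorem11 = search , 818 , λ I → Correctness.search-solves I 818 ≤-refl
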